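{- Let $q$ be a prime power and $\mathbb{F}=\mathbb{F}_q$. There exist $c>0$ and $n_0$, depending only on $q$, such that for every $n\ge n_0$ divisible by $q$, every integer $d\ge0$ and every polynomial $P\in\mathbb{F}[x_1,\dots,x_n]$ of degree at most $d$ such that $P(\mathbf{a})\ne0$ for some $\mathbf{a}\in\mathbb{F}^n_\mu$, we have $$\Pr_{\mathbf{b}\sim\mathbb{F}^n_\mu}[P(\mathbf{b})\ne0]\ \ge\ \delta(q,d)-\frac{1}{n^{c}},$$ where $\mathbf{b}$ is uniform on $\mathbb{F}^n_\mu$.
   Context: $\mathbb{F}^n_\mu$ denotes the balanced multislice $\{\mathbf{a}\in\mathbb{F}^n:\ |\{i:a_i=\sigma\}|=n/q\ \forall\sigma\in\mathbb{F}\}$. $\delta(q,d)=(1-\beta/q)\,q^{ -\alpha}$, where $\alpha$ and $\beta$ are the quotient and remainder when $d$ is divided by $q-1$. -}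

module Defs where

open import Level using (0ℓ)
open import Data.Nat as ℕ using (ℕ; zero; suc; _∸_; _≤_)
open import Data.Nat.DivMod using (_/_; _%_)
open import Data.Nat.Primality using (Prime)
open import Data.Integer as ℤ using (ℤ; +_)
open import Data.Rational as ℚ using (ℚ; 0ℚ; 1ℚ)
open import Data.List as List using (List; []; _∷_; length; filter; concatMap; map)
open import Data.List.Relation.Unary.All as All using (All)
open import Data.List.Membership.Propositional using (_∈_)
open import Data.List.Relation.Unary.Unique.Propositional using (Unique)
open import Data.Vec as Vec using (Vec; []; _∷_; toList)
open import Data.Product using (Σ; ∃; ∃-syntax; _×_; _,_)
open import Data.Sum using (_⊎_)
open import Relation.Nullary using (¬_; Dec; yes; no; ¬?)
open import Relation.Nullary.Decidable using (_×-dec_)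
open import Relation.Binary.PropositionalEquality using (_≡_; _≢_)
open import Algebra.Structures using (IsCommutativeRing)

record FiniteField : Set₁ where
  field
    Carrier : Set
    _+_ _*_ : Carrier → Carrier → Carrier
    -_      : Carrier → Carrier
    0# 1#   : Carrier
    isCommutativeRing : IsCommutativeRing _≡_ _+_ _*_ -_ 0# 1#
    _≟_     : (x y : Carrier) → Dec (x ≡ y)
    0≢1     : 0# ≢ 1#
    inverse : ∀ x → x ≢ 0# → ∃[ y ] (x * y ≡ 1#)
    elems   : List Carrier
    complete : ∀ x → x ∈ elems
    unique  : Unique elems

  card : ℕ
  card = length elems

IsPrimePower : ℕ → Set
IsPrimePower q = ∃[ p ] ∃[ k ] (Prime p × 1 ≤ k × q ≡ p ℕ.^ k)

-- a / b as a rational (b = 0 gives 0; never used with b = 0 below)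
frac : ℕ → ℕ → ℚ
frac a zero    = 0ℚ
frac a (suc b) = (+ a) ℚ./ suc b

powℚ : ℚ → ℕ → ℚ
powℚ x zero    = 1ℚ
powℚ x (suc k) = x ℚ.* powℚ x k

-- δ(q,d) = (1 - β/q) q^{-α} = (q - β) / q^{α+1},
-- α = d div (q-1), β = d mod (q-1).  (q ≥ 2 for fields; 0 otherwise.)
δ : ℕ → ℕ → ℚ
δ (suc (suc r)) d =
  frac (q ∸ (d % suc r)) (q ℕ.^ suc (d / suc r))
  where q = suc (suc r)
δ _ d = 0ℚ

module _ (F : FiniteField) where
  open FiniteField F

  allVecs : {A : Set} → List A → (n : ℕ) → List (Vec A n)
  allVecs xs zero    = [] ∷ []
  allVecs xs (suc n) = concatMap (λ x → map (x ∷_) (allVecs xs n)) xs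

  count : {n : ℕ} → Carrier → Vec Carrier n → ℕ
  count σ a = length (filter (λ x → x ≟ σ) (toList a))

  -- a ∈ F^n_μ : every σ occurs exactly n/q times (written count·q = n)
  InMultislice : (n : ℕ) → Vec Carrier n → Set
  InMultislice n a = ∀ σ → count σ a ℕ.* card ≡ n

  inMultislice? : (n : ℕ) (a : Vec Carrier n) →
                  Dec (All (λ σ → count σ a ℕ.* card ≡ n) elems)
  inMultislice? n a = All.all? (λ σ → count σ a ℕ.* card ℕ.≟ n) elems

  record Term (n : ℕ) : Set where
    constructor term
    field
      coeff : Carrier
      exps  : Vec ℕ n

  Poly : ℕ → Set
  Poly n = List (Term n)

  powF : Carrier → ℕ → Carrier
  powF x zero    = 1#
  powF x (suc k) = x * powF x k

  evalTerm : {n : ℕ} → Term n → Vec Carrier n → Carrier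
  evalTerm (term c e) a = c * Vec.foldr _ _*_ 1# (Vec.zipWith powF a e)

  eval : {n : ℕ} → Poly n → Vec Carrier n → Carrier
  eval P a = List.foldr (λ t r → evalTerm t a + r) 0# P

  DegreeAtMost : {n : ℕ} → ℕ → Poly n → Set
  DegreeAtMost d P = All (λ t → Vec.sum (Term.exps t) ≤ d) P

  probNonzero : (n : ℕ) → Poly n → ℚ
  probNonzero n P =
    frac (length (filter (λ b → inMultislice? n b ×-dec ¬? (eval P b ≟ 0#))
                         (allVecs elems n)))
         (length (filter (inMultislice? n) (allVecs elems n)))

-- D ≤ n^{-1/k}  (for k ≥ 1, n ≥ 1), written without real powers:
-- either D ≤ 0, or D^k · n ≤ 1.
AtMostInvRoot : ℕ → ℕ → ℚ → Set
AtMostInvRoot k n D = D ℚ.≤ 0ℚ ⊎ powℚ D k ℚ.* ((+ n) ℚ./ 1) ℚ.≤ 1ℚ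

{-# OPTIONS --safe #-}
module Submission where

open import Defs
open import Data.Nat using (ℕ; suc; _≤_)
open import Data.Nat.Divisibility using (_∣_)
open import Data.Rational using (_-_)
open import Data.Product using (∃-syntax; _×_)
open import Data.Vec using (Vec)
open import Relation.Binary.PropositionalEquality using (_≡_; _≢_)

open import Level using (0ℓ)
open import Algebra.Bundles using (CommutativeRing)
import Algebra.Properties.Group as GroupProperties
import Algebra.Solver.Ring.NaturalCoefficients.Default as RingSolver
open import Data.Empty using (⊥; ⊥-elim)
open import Data.Fin using (Fin; zero; suc)
import Data.Fin.Properties as FinP
import Data.Integer as ℤ
import Data.Integer.Properties as ℤP
open import Data.List as List using (List; []; _∷_; length; filter; map; _++_; cartesianProduct; allFin; take)
import Data.List.Membership.DecPropositional as DecMembership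
open import Data.List.Membership.Propositional using (_∈_; _∉_; lose)
open import Data.List.Membership.Propositional.Properties using (∈-allFin; ∈-++⁻; ∈-++⁺ˡ; ∈-++⁺ʳ; ∈-map⁺; ∈-map⁻; ∈-concatMap⁺; ∈-filter⁺; ∈-cartesianProduct⁺)
import Data.List.Properties as ListP
open import Data.List.Relation.Unary.All as All using (All; []; _∷_)
import Data.List.Relation.Unary.All.Properties as AllP
open import Data.List.Relation.Unary.AllPairs using ([]; _∷_)
open import Data.List.Relation.Unary.Any as Any using (Any; here; there)
open import Data.List.Relation.Unary.Unique.Propositional using (Unique)
import Data.List.Relation.Unary.Unique.Propositional.Properties as Uniq
open import Data.Nat as ℕ using (zero; _+_; _*_; _∸_; _^_; _<_; z≤n; s≤s; s≤s⁻¹; z<s; >-nonZero⁻¹)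
open import Data.Nat.Divisibility using (divides; n∣m*n)
open import Data.Nat.DivMod using (_/_; _%_; m≡m%n+[m/n]*n; m%n<n; [m+kn]%n≡m%n; m<n⇒m%n≡m; m<n⇒m/n≡0; m*n/n≡m; +-distrib-/-∣ʳ)
open import Data.Nat.Properties hiding (_≟_)
import Data.Nat.Solver
open import Data.Product using (∃; _,_; proj₁; proj₂)
open import Data.Product.Properties using () renaming (≡-dec to ≡-dec×)
open import Data.Rational as ℚ using (ℚ; 0ℚ; 1ℚ; toℚᵘ)
import Data.Rational.Properties as ℚP
open import Data.Rational.Unnormalised as ℚᵘ using (mkℚᵘ; *≤*)
import Data.Rational.Unnormalised.Properties as ℚᵘP
open import Data.Sum using (_⊎_; inj₁; inj₂; [_,_]′)
open import Data.Vec as Vec using ([]; _∷_; lookup; _[_]≔_)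
import Data.Vec.Properties as VecP
open import Function using (_∘_)
open import Relation.Binary.PropositionalEquality using (refl; sym; trans; cong; cong₂; subst; subst₂; module ≡-Reasoning)
open import Relation.Nullary using (¬_; Dec; yes; no; ¬?)
open import Relation.Nullary.Decidable using (_×-dec_; map′; decidable-stable)

-- Fix a balanced slice with m copies of each value. A block (e; r_σ)_{σ ≠ 0} of q coordinates on which
-- x_{r_σ} = x_e + σ stays balanced when x_e runs over F, so restricting P to it gives a polynomial in
-- y = x_e over the slice with m - 1 copies; if it has degree j in y, the leading coefficient has degree
-- ≤ d - j, and (1 - j/q) δ(q,d-j) ≥ δ(q,d). Averaging over random blocks through a fixed coordinate e
-- loses only the blocks on which P vanishes.
--
-- A function of degree ≤ d that is nonzero at a must be nonzero at another point of any cube spanned by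
-- d + 1 disjoint swaps at a; hence all but d coordinates r can be given any prescribed value without
-- killing P, so a random block is bad with probability O_q(d/m).
--
-- If P is not constant on the slice, P ≠ P∘(u u′) for some u, u′. Applying the previous remark to the
-- difference, for most (r_σ) the restriction has degree j ≥ 1 for the block at u or for the block at u′,
-- as otherwise P would be invariant under the swap. So averaging over e ∈ {u, u′}, the degree drops half
-- of the time, and the relative losses satisfy ε(m,d) ≤ O_q(d/m) + (ε(m-1,d) + ε(m-1,d-1))/2, whence
-- ε(m,d) = O_q(d²/m). Finally δ(q,d) d² is bounded, so the total error is O_q(1/n) ≤ n^(-1/2).

-- If the degree never dropped, the losses `O(d/m)` would add up over the smaller slices like a
-- harmonic sum, which is unbounded. With a drop half of the time, the gap between the constants for
-- `d` and `d - 1` pays for the bad blocks at every step.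
--
-- Densities are compared as products of natural numbers, with denominators cleared. A block is not
-- deleted: its coordinates are frozen at `0#`, so every slice of the induction consists of vectors
-- of the original length. Restrictions and leading coefficients are functions, and the degree in
-- `y` is read off from the coefficients that do not vanish identically on the smaller slice.
--
-- A block is drawn one coordinate at a time, weighted by the points that follow it: a point of a
-- slice with `m` copies offers exactly `m` coordinates for each offset. The blocks at `u` and `u′`
-- share all their other coordinates, so that moving along one and back along the other changes only
-- the values at `u` and `u′`.

module NatSolver = Data.Nat.Solver.+-*-Solver using (solve; con; _:+_; _:*_; _:=_)

private variable
  A B : Set
  P Q : Set

-- Finite sums and counting by indicators.

∑ : List A → (A → ℕ) → ℕ
∑ []       f = 0
∑ (x ∷ xs) f = f x + ∑ xs f

⟦_⟧ : Dec P → ℕ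
⟦ yes _ ⟧ = 1
⟦ no _ ⟧  = 0

⟦⟧≤1 : (d : Dec P) → ⟦ d ⟧ ≤ 1
⟦⟧≤1 (yes _) = s≤s z≤n
⟦⟧≤1 (no _)  = z≤n

⟦⟧-true : (d : Dec P) → P → ⟦ d ⟧ ≡ 1
⟦⟧-true (yes _) p = refl
⟦⟧-true (no ¬p) p = ⊥-elim (¬p p)

⟦⟧-false : (d : Dec P) → ¬ P → ⟦ d ⟧ ≡ 0
⟦⟧-false (yes p) ¬p = ⊥-elim (¬p p)
⟦⟧-false (no _)  ¬p = refl

⟦⟧-mono : (d : Dec P) (e : Dec Q) → (P → Q) → ⟦ d ⟧ ≤ ⟦ e ⟧
⟦⟧-mono (yes p) e f = ≤-reflexive (sym (⟦⟧-true e (f p)))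
⟦⟧-mono (no _)  e f = z≤n

⟦⟧-cong : (d : Dec P) (e : Dec Q) → (P → Q) → (Q → P) → ⟦ d ⟧ ≡ ⟦ e ⟧
⟦⟧-cong d e f g = ≤-antisym (⟦⟧-mono d e f) (⟦⟧-mono e d g)

⟦×⟧ : (d : Dec P) (e : Dec Q) → ⟦ d ×-dec e ⟧ ≡ ⟦ d ⟧ * ⟦ e ⟧
⟦×⟧ (yes _) (yes _) = refl
⟦×⟧ (yes _) (no _)  = refl
⟦×⟧ (no _)  _       = refl

⟦¬⟧ : (d : Dec P) → ⟦ ¬? d ⟧ + ⟦ d ⟧ ≡ 1
⟦¬⟧ (yes _) = refl
⟦¬⟧ (no _)  = refl

∑-cong : ∀ (xs : List A) {f g : A → ℕ} → (∀ x → f x ≡ g x) → ∑ xs f ≡ ∑ xs g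
∑-cong []       h = refl
∑-cong (x ∷ xs) h = cong₂ _+_ (h x) (∑-cong xs h)

∑-mono : ∀ (xs : List A) {f g : A → ℕ} → (∀ x → f x ≤ g x) → ∑ xs f ≤ ∑ xs g
∑-mono []       h = z≤n
∑-mono (x ∷ xs) h = +-mono-≤ (h x) (∑-mono xs h)

∑-+ : ∀ (xs : List A) (f g : A → ℕ) → ∑ xs (λ x → f x + g x) ≡ ∑ xs f + ∑ xs g
∑-+ []       f g = refl
∑-+ (x ∷ xs) f g rewrite ∑-+ xs f g =
  solve 4 (λ a b c d → a :+ b :+ (c :+ d) := a :+ c :+ (b :+ d)) refl (f x) (g x) (∑ xs f) (∑ xs g)
  where open NatSolver

∑-*ˡ : ∀ (xs : List A) c (f : A → ℕ) → ∑ xs (λ x → c * f x) ≡ c * ∑ xs f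
∑-*ˡ []       c f = sym (*-zeroʳ c)
∑-*ˡ (x ∷ xs) c f rewrite ∑-*ˡ xs c f = sym (*-distribˡ-+ c (f x) (∑ xs f))

∑-*ʳ : ∀ (xs : List A) c (f : A → ℕ) → ∑ xs (λ x → f x * c) ≡ ∑ xs f * c
∑-*ʳ xs c f = trans (∑-cong xs (λ x → *-comm (f x) c)) (trans (∑-*ˡ xs c f) (*-comm c (∑ xs f)))

∑-zero : ∀ (xs : List A) {f : A → ℕ} → (∀ x → f x ≡ 0) → ∑ xs f ≡ 0
∑-zero []       h = refl
∑-zero (x ∷ xs) h = cong₂ _+_ (h x) (∑-zero xs h)

∑-one : ∀ (xs : List A) → ∑ xs (λ _ → 1) ≡ length xs
∑-one []       = refl
∑-one (x ∷ xs) = cong suc (∑-one xs)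

∑-swap : ∀ (xs : List A) (ys : List B) (f : A → B → ℕ) →
  ∑ xs (λ x → ∑ ys (f x)) ≡ ∑ ys (λ y → ∑ xs (λ x → f x y))
∑-swap []       ys f = sym (∑-zero ys (λ _ → refl))
∑-swap (x ∷ xs) ys f rewrite ∑-swap xs ys f = sym (∑-+ ys (f x) (λ y → ∑ xs (λ x → f x y)))

∑-++ : ∀ (xs ys : List A) (f : A → ℕ) → ∑ (xs ++ ys) f ≡ ∑ xs f + ∑ ys f
∑-++ []       ys f = refl
∑-++ (x ∷ xs) ys f rewrite ∑-++ xs ys f = sym (+-assoc (f x) _ _)

∑-map : ∀ (g : A → B) (xs : List A) (f : B → ℕ) → ∑ (map g xs) f ≡ ∑ xs (λ x → f (g x))
∑-map g []       f = refl
∑-map g (x ∷ xs) f = cong (f (g x) +_) (∑-map g xs f)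

∑-cartesian : ∀ (xs : List A) (ys : List B) (f : A × B → ℕ) →
  ∑ (cartesianProduct xs ys) f ≡ ∑ xs (λ x → ∑ ys (λ y → f (x , y)))
∑-cartesian []       ys f = refl
∑-cartesian (x ∷ xs) ys f =
  trans (∑-++ (map (x ,_) ys) (cartesianProduct xs ys) f)
        (cong₂ _+_ (∑-map (x ,_) ys f) (∑-cartesian xs ys f))

∈⇒≤∑ : ∀ {x} {xs : List A} (f : A → ℕ) → x ∈ xs → f x ≤ ∑ xs f
∈⇒≤∑ {xs = x ∷ xs} f (here refl) = m≤m+n (f x) (∑ xs f)
∈⇒≤∑ {xs = x ∷ xs} f (there p)   = ≤-trans (∈⇒≤∑ f p) (m≤n+m (∑ xs f) (f x))

∑-all-false : ∀ {P : A → Set} (P? : ∀ x → Dec (P x)) {xs} → All (λ x → ¬ P x) xs → ∑ xs (λ x → ⟦ P? x ⟧) ≡ 0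
∑-all-false P? []       = refl
∑-all-false P? (n ∷ ns) = cong₂ _+_ (⟦⟧-false (P? _) n) (∑-all-false P? ns)

∑-unique≤1 : ∀ {P : A → Set} (P? : ∀ x → Dec (P x)) {xs} → Unique xs →
  (∀ {x y} → P x → P y → x ≡ y) → ∑ xs (λ x → ⟦ P? x ⟧) ≤ 1
∑-unique≤1 P? []       inj = z≤n
∑-unique≤1 P? {x ∷ xs} (x∉ ∷ u) inj with P? x
... | yes px = ≤-reflexive (cong suc (∑-all-false P? (All.map (λ x≢y py → x≢y (inj px py)) x∉)))
... | no _   = ∑-unique≤1 P? u inj

∑-unique≡1 : ∀ {P : A → Set} (P? : ∀ x → Dec (P x)) {xs} → Unique xs →
  (∀ {x y} → P x → P y → x ≡ y) → ∀ {x} → x ∈ xs → P x → ∑ xs (λ x → ⟦ P? x ⟧) ≡ 1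
∑-unique≡1 P? u inj {x} x∈ px = ≤-antisym (∑-unique≤1 P? u inj)
  (subst (_≤ _) (⟦⟧-true (P? x) px) (∈⇒≤∑ (λ x → ⟦ P? x ⟧) x∈))

length-filter-∑ : ∀ {P : A → Set} (P? : ∀ x → Dec (P x)) xs → length (filter P? xs) ≡ ∑ xs (λ x → ⟦ P? x ⟧)
length-filter-∑ P? []       = refl
length-filter-∑ P? (x ∷ xs) with P? x
... | yes _ = cong suc (length-filter-∑ P? xs)
... | no _  = length-filter-∑ P? xs

-- Each `x` is charged to `φ x`, and injectivity on `P` leaves at most one charge at each `y`.
∑-injection : ∀ {P : A → Set} {Q : B → Set} (P? : ∀ x → Dec (P x)) (Q? : ∀ y → Dec (Q y))
  (_≟_ : (x y : B) → Dec (x ≡ y)) {xs : List A} {ys : List B} → Unique xs → (∀ y → y ∈ ys) →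
  (φ : A → B) → (∀ {x} → P x → Q (φ x)) → (∀ {x x′} → P x → P x′ → φ x ≡ φ x′ → x ≡ x′) →
  ∑ xs (λ x → ⟦ P? x ⟧) ≤ ∑ ys (λ y → ⟦ Q? y ⟧)
∑-injection {P = P} {Q = Q} P? Q? _≟_ {xs} {ys} u c φ φ-ok φ-inj = begin
  ∑ xs (λ x → ⟦ P? x ⟧)                         ≤⟨ ∑-mono xs fibre ⟩
  ∑ xs (λ x → ∑ ys (λ y → ⟦ R? y x ⟧))          ≡⟨ ∑-swap xs ys (λ x y → ⟦ R? y x ⟧) ⟩
  ∑ ys (λ y → ∑ xs (λ x → ⟦ R? y x ⟧))          ≤⟨ ∑-mono ys atMostOne ⟩
  ∑ ys (λ y → ⟦ Q? y ⟧)                         ∎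
  where
  open ≤-Reasoning
  R? : ∀ y x → Dec (P x × φ x ≡ y)
  R? y x = P? x ×-dec (φ x ≟ y)
  fibre : ∀ x → ⟦ P? x ⟧ ≤ ∑ ys (λ y → ⟦ R? y x ⟧)
  fibre x = ≤-trans (⟦⟧-mono (P? x) (R? (φ x) x) (λ p → p , refl)) (∈⇒≤∑ (λ y → ⟦ R? y x ⟧) (c (φ x)))
  atMostOne : ∀ y → ∑ xs (λ x → ⟦ R? y x ⟧) ≤ ⟦ Q? y ⟧
  atMostOne y with Q? y
  ... | yes _ = ∑-unique≤1 (R? y) u (λ (p , e) (p′ , e′) → φ-inj p p′ (trans e (sym e′)))
  ... | no ¬q = ≤-reflexive (∑-zero xs (λ x → ⟦⟧-false (R? y x) (λ (p , e) → ¬q (subst Q e (φ-ok p)))))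

-- Arithmetic of δ(q,d).

-- δ(q,d) = num/den for q = r + 2.
num den : ℕ → ℕ → ℕ
num r d = suc (suc r) ∸ d % suc r
den r d = suc (suc r) ^ suc (d / suc r)

private
  ≤-diff : ∀ {a b} → a ≤ b → ∃[ c ] (b ≡ a + c)
  ≤-diff {a} {b} le = b ∸ a , sym (m+[n∸m]≡n le)

  %-of : ∀ r α {β} → β < suc r → (β + α * suc r) % suc r ≡ β
  %-of r α {β} β< = trans ([m+kn]%n≡m%n β α (suc r)) (m<n⇒m%n≡m β<)

  /-of : ∀ r α {β} → β < suc r → (β + α * suc r) / suc r ≡ α
  /-of r α {β} β< = trans (+-distrib-/-∣ʳ β (n∣m*n α)) (cong₂ _+_ (m<n⇒m/n≡0 β<) (m*n/n≡m α (suc r)))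

  -- The case in which subtracting `j` from `d` borrows nothing from the quotient; the two sides
  -- differ by `j * (β ∸ j)`.
  same-quotient : ∀ {q j β} → j ≤ β → β ≤ q → q * (q ∸ β) ≤ (q ∸ j) * (q ∸ (β ∸ j))
  same-quotient {j = j} j≤β β≤q with ≤-diff j≤β
  ... | k , refl with ≤-diff β≤q
  ...   | e , refl rewrite m+n∸m≡n j k = begin
    (j + k + e) * (j + k + e ∸ (j + k))   ≡⟨ cong ((j + k + e) *_) (m+n∸m≡n (j + k) e) ⟩
    (j + k + e) * e                       ≤⟨ m≤m+n _ (k * j) ⟩
    (j + k + e) * e + k * j               ≡⟨ solve 3 (λ j k e → (j :+ k :+ e) :* e :+ k :* j := (k :+ e) :* (j :+ e)) refl j k e ⟩
    (k + e) * (j + e)                     ≡⟨ sym (cong₂ _*_ (trans (cong (_∸ j) (+-assoc j k e)) (m+n∸m≡n j (k + e)))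
                                               (trans (cong (_∸ k) (solve 3 (λ j k e → j :+ k :+ e := k :+ (j :+ e)) refl j k e)) (m+n∸m≡n k (j + e)))) ⟩
    (j + k + e ∸ j) * (j + k + e ∸ k)     ∎
    where
    open ≤-Reasoning
    open NatSolver

-- This is `δ(q,d) ≤ (1 - j/q) δ(q,d-j)` with denominators cleared. Since `j ≤ q - 1`, the quotient
-- falls by at most one.
num-drop : ∀ r d j → j ≤ d → j ≤ suc r →
  suc (suc r) * num r d * den r (d ∸ j) ≤ (suc (suc r) ∸ j) * num r (d ∸ j) * den r d
num-drop r d j j≤d j≤s = subst
  (λ d → j ≤ d → q * num r d * den r (d ∸ j) ≤ (q ∸ j) * num r (d ∸ j) * den r d)
  (sym (m≡m%n+[m/n]*n d (suc r))) (λ j≤ → core (d / suc r) (d % suc r) (m%n<n d (suc r)) j≤) j≤d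
  where
  q = suc (suc r)
  open ≤-Reasoning
  core : ∀ α β → β < suc r → j ≤ β + α * suc r → q * num r (β + α * suc r) * den r (β + α * suc r ∸ j)
    ≤ (q ∸ j) * num r (β + α * suc r ∸ j) * den r (β + α * suc r)
  core α β β< j≤ rewrite %-of r α β< | /-of r α β< with j ≤? β
  ... | yes j≤β rewrite +-∸-comm (α * suc r) j≤β
                      | %-of r α (≤-<-trans (m∸n≤m β j) β<) | /-of r α (≤-<-trans (m∸n≤m β j) β<) =
    *-monoˡ-≤ (q ^ suc α) (same-quotient j≤β (≤-trans (<⇒≤ β<) (n≤1+n (suc r))))
  core zero β β< j≤ | no j≰β with () ← j≰β (≤-trans j≤ (≤-reflexive (+-identityʳ β)))
  -- A borrow: with `suc r = j + e` the remainder becomes `β + e` and the quotient `α`. The factor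
  -- `q` on the left makes up for the smaller power, and with `j = suc (β + k)` what remains is
  -- `2 + k + e ≤ (1 + e) * (2 + k)`.
  core (suc α) β β< j≤ | no j≰β with ≤-diff (≰⇒> j≰β)
  ... | k , refl with ≤-diff j≤s
  ...   | e , s≡ = begin
    q * (q ∸ β) * den r (β + suc α * suc r ∸ j)        ≡⟨ cong (λ z → q * (q ∸ β) * den r z) shift ⟩
    q * (q ∸ β) * den r (β + e + α * suc r)            ≡⟨ cong (λ z → q * (q ∸ β) * q ^ suc z) (/-of r α β′<) ⟩
    q * (q ∸ β) * q ^ suc α                            ≡⟨ solve 3 (λ q a b → q :* a :* b := a :* (q :* b)) refl q (q ∸ β) (q ^ suc α) ⟩
    (q ∸ β) * q ^ suc (suc α)                          ≤⟨ *-monoˡ-≤ (q ^ suc (suc α)) main ⟩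
    (q ∸ j) * (q ∸ (β + e)) * q ^ suc (suc α)          ≡⟨ cong (λ z → (q ∸ j) * (q ∸ z) * q ^ suc (suc α)) (sym (%-of r α β′<)) ⟩
    (q ∸ j) * num r (β + e + α * suc r) * q ^ suc (suc α)
                                                       ≡⟨ cong (λ z → (q ∸ j) * num r z * q ^ suc (suc α)) (sym shift) ⟩
    (q ∸ j) * num r (β + suc α * suc r ∸ j) * q ^ suc (suc α) ∎
    where
    open NatSolver
    shift : β + suc α * suc r ∸ j ≡ β + e + α * suc r
    shift = trans (cong (_∸ j) (trans (cong (λ z → β + (z + α * suc r)) s≡)
      (solve 4 (λ β j e a → β :+ (j :+ e :+ a) := j :+ (β :+ e :+ a)) refl β j e (α * suc r)))) (m+n∸m≡n j _)
    β′< : β + e < suc r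
    β′< = subst (β + e <_) (sym s≡) (+-monoˡ-≤ e (m≤m+n (suc β) k))
    main : q ∸ β ≤ (q ∸ j) * (q ∸ (β + e))
    main rewrite s≡ = begin
      suc (suc (β + k) + e) ∸ β         ≡⟨ trans (cong (_∸ β) (solve 3 (λ β k e → con 1 :+ (con 1 :+ (β :+ k) :+ e) := β :+ (con 2 :+ k :+ e)) refl β k e)) (m+n∸m≡n β (2 + k + e)) ⟩
      2 + k + e                         ≤⟨ m≤m+n (2 + k + e) (e + e * k) ⟩
      2 + k + e + (e + e * k)           ≡⟨ solve 2 (λ k e → con 2 :+ k :+ e :+ (e :+ e :* k) := (con 1 :+ e) :* (con 2 :+ k)) refl k e ⟩
      (1 + e) * (2 + k)                 ≡⟨ sym (cong₂ _*_
          (trans (cong (_∸ suc (β + k)) (solve 2 (λ b e → con 1 :+ (con 1 :+ b :+ e) := con 1 :+ b :+ (con 1 :+ e)) refl (β + k) e)) (m+n∸m≡n (suc (β + k)) (1 + e)))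
          (trans (cong (_∸ (β + e)) (solve 3 (λ β k e → con 1 :+ (con 1 :+ (β :+ k) :+ e) := β :+ e :+ (con 2 :+ k)) refl β k e)) (m+n∸m≡n (β + e) (2 + k)))) ⟩
      (suc (suc (β + k) + e) ∸ suc (β + k)) * (suc (suc (β + k) + e) ∸ (β + e)) ∎

num≤den : ∀ r d → num r d ≤ den r d
num≤den r d = ≤-trans (m∸n≤m q (d % suc r)) (≤-trans (≤-reflexive (sym (*-identityʳ q))) (*-monoʳ-≤ q (m^n>0 q (d / suc r))))
  where q = suc (suc r)

-- Arithmetic of the losses.

-- K r d bounds the number of coordinates excluded when a block is chosen coordinate by coordinate, and
-- δ(q,d) (1 - loss r d / m) is the density obtained on a slice with m copies of each value.
K : ℕ → ℕ → ℕ
K r d = 3 * d + (3 + r)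

loss : ℕ → ℕ → ℕ
loss r d = d * (2 + 2 * (suc r * K r d))

K-mono : ∀ r {d e} → d ≤ e → K r d ≤ K r e
K-mono r le = +-monoˡ-≤ (3 + r) (*-monoʳ-≤ 3 le)

loss-mono : ∀ r {d e} → d ≤ e → loss r d ≤ loss r e
loss-mono r le = *-mono-≤ le (+-monoʳ-≤ 2 (*-monoʳ-≤ 2 (*-monoʳ-≤ (suc r) (K-mono r le))))

-- The increment between consecutive degrees is what `loss-recursion` spends; `loss` consists of `d`
-- such increments, all taken at the largest `K`.
loss-suc : ∀ r d → 2 + 2 * (suc r * K r (suc d)) + loss r d ≤ loss r (suc d)
loss-suc r d = +-monoʳ-≤ _ (*-monoʳ-≤ d (+-monoʳ-≤ 2 (*-monoʳ-≤ 2 (*-monoʳ-≤ (suc r) (K-mono r (n≤1+n d))))))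

-- Cleared of denominators this is `(1 - k/m)^s ≥ 1 - s k/m`: avoiding `k` excluded coordinates in
-- each of `s` draws costs only a linear loss.
bernoulli : ∀ m k s → m ^ s * (m ∸ s * k) ≤ (m ∸ k) ^ s * m
bernoulli m k zero    = ≤-refl
bernoulli m k (suc s) = begin
  m * m ^ s * (m ∸ (k + s * k))         ≡⟨ solve 3 (λ m p a → m :* p :* a := p :* (m :* a)) refl m (m ^ s) (m ∸ (k + s * k)) ⟩
  m ^ s * (m * (m ∸ (k + s * k)))       ≤⟨ *-monoʳ-≤ (m ^ s) split ⟩
  m ^ s * ((m ∸ k) * (m ∸ s * k))       ≡⟨ solve 3 (λ p a b → p :* (a :* b) := a :* (p :* b)) refl (m ^ s) (m ∸ k) (m ∸ s * k) ⟩
  (m ∸ k) * (m ^ s * (m ∸ s * k))       ≤⟨ *-monoʳ-≤ (m ∸ k) (bernoulli m k s) ⟩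
  (m ∸ k) * ((m ∸ k) ^ s * m)           ≡⟨ sym (*-assoc (m ∸ k) _ m) ⟩
  (m ∸ k) * (m ∸ k) ^ s * m             ∎
  where
  open ≤-Reasoning
  open NatSolver
  split : m * (m ∸ (k + s * k)) ≤ (m ∸ k) * (m ∸ s * k)
  split with k + s * k ≤? m
  ... | no k≰m = ≤-trans (≤-reflexive (trans (cong (m *_) (m≤n⇒m∸n≡0 (<⇒≤ (≰⇒> k≰m)))) (*-zeroʳ m))) z≤n
  ... | yes k≤m with ≤-diff k≤m
  ...   | e , refl = begin
    (k + s * k + e) * (k + s * k + e ∸ (k + s * k))      ≡⟨ cong ((k + s * k + e) *_) (m+n∸m≡n (k + s * k) e) ⟩
    (k + s * k + e) * e                                  ≤⟨ m≤m+n _ (k * (s * k)) ⟩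
    (k + s * k + e) * e + k * (s * k)                    ≡⟨ solve 3 (λ k l e → (k :+ l :+ e) :* e :+ k :* l := (l :+ e) :* (k :+ e)) refl k (s * k) e ⟩
    (s * k + e) * (k + e)                                ≡⟨ sym (cong₂ _*_ (trans (cong (_∸ k) (+-assoc k (s * k) e)) (m+n∸m≡n k _))
                                                              (trans (cong (_∸ s * k) (solve 3 (λ k l e → k :+ l :+ e := l :+ (k :+ e)) refl k (s * k) e)) (m+n∸m≡n (s * k) _))) ⟩
    (k + s * k + e ∸ k) * (k + s * k + e ∸ s * k)        ∎

-- Divided by `2 m (m + 1)`, this bounds `1 - C/(m+1)` by the average of `1 - C/m` and `1 - C′/m`,
-- times `1 - R/(m+1)`. Averaging gains `(C - C′)/(2m)`, at least `(1 + R)/m`. Of this, `R/m` pays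
-- for the bad blocks, and `1/m` for replacing `C/m` by `C/(m+1)`, as `C ≤ m`.
loss-recursion : ∀ {m C C′ R} → 2 + 2 * R + C′ ≤ C → C ≤ m →
  2 * m * (suc m ∸ C) ≤ ((m ∸ C) + (m ∸ C′)) * (suc m ∸ R)
loss-recursion {m} {C} {C′} {R} C′≤C C≤m with ≤-diff C′≤C
... | g , refl with ≤-diff C≤m
...   | e , refl = begin
  2 * (c + e) * (suc (c + e) ∸ c)                   ≡⟨ cong (2 * (c + e) *_) (trans (cong (_∸ c) (sym (+-suc c e))) (m+n∸m≡n c (suc e))) ⟩
  2 * (c + e) * suc e                               ≤⟨ m≤m+n _ (2 * e + 2 + 4 * R + 2 * R * C′ + 2 * R * R + 3 * R * g + 3 * g + g * e + g * C′ + g * g) ⟩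
  2 * (c + e) * suc e + (2 * e + 2 + 4 * R + 2 * R * C′ + 2 * R * R + 3 * R * g + 3 * g + g * e + g * C′ + g * g)
    ≡⟨ solve 4 (λ R C′ g e → con 2 :* (con 2 :+ con 2 :* R :+ C′ :+ g :+ e) :* (con 1 :+ e) :+
          (con 2 :* e :+ con 2 :+ con 4 :* R :+ con 2 :* R :* C′ :+ con 2 :* R :* R :+ con 3 :* R :* g :+ con 3 :* g :+ g :* e :+ g :* C′ :+ g :* g)
          := (e :+ (con 2 :+ con 2 :* R :+ g :+ e)) :* (con 3 :+ R :+ C′ :+ g :+ e)) refl R C′ g e ⟩
  (e + (2 + 2 * R + g + e)) * (3 + R + C′ + g + e)
    ≡⟨ sym (cong₂ _*_ (cong₂ _+_ (m+n∸m≡n c e)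
         (trans (cong (_∸ C′) (solve 4 (λ R C′ g e → con 2 :+ con 2 :* R :+ C′ :+ g :+ e := C′ :+ (con 2 :+ con 2 :* R :+ g :+ e)) refl R C′ g e)) (m+n∸m≡n C′ _)))
         (trans (cong (_∸ R) (solve 4 (λ R C′ g e → con 1 :+ (con 2 :+ con 2 :* R :+ C′ :+ g :+ e) := R :+ (con 3 :+ R :+ C′ :+ g :+ e)) refl R C′ g e)) (m+n∸m≡n R _))) ⟩
  ((c + e ∸ c) + (c + e ∸ C′)) * (suc (c + e) ∸ R)  ∎
  where
  open ≤-Reasoning
  open NatSolver
  c = 2 + 2 * R + C′ + g

-- Applies Bernoulli's inequality and the recursion for the losses to the averaged inequality, then
-- cancels the positive factor `2 * m * suc m ^ s`. The sum `N + N` counts the nonzeros once for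
-- each of the two coordinates `u` and `u′`.
combine : ∀ {m s k a b N X C C′} → 2 + 2 * (s * k) + C′ ≤ C → C ≤ m →
  a * ((m ∸ C) + (m ∸ C′)) * (suc m ∸ k) ^ s * X ≤ (N + N) * suc m ^ s * (b * m) →
  a * (suc m ∸ C) * X ≤ N * (b * suc m)
combine {m} {s} {k} {a} {b} {N} {X} {C} {C′} C′≤C C≤m h =
  *-cancelˡ-≤ (2 * m * M ^ s) {{m*n≢0 (2 * m) (M ^ s) {{m*n≢0 2 m {{_}} {{ℕ.>-nonZero (≤-trans z<s (≤-trans C′≤C C≤m))}}}} {{m^n≢0 M s}}}} (begin
  2 * m * M ^ s * (a * (M ∸ C) * X)                         ≡⟨ solve 5 (λ t p a x y → t :* p :* (a :* x :* y) := p :* a :* y :* (t :* x)) refl (2 * m) (M ^ s) a (M ∸ C) X ⟩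
  M ^ s * a * X * (2 * m * (M ∸ C))                         ≤⟨ *-monoʳ-≤ (M ^ s * a * X) (loss-recursion {R = s * k} C′≤C C≤m) ⟩
  M ^ s * a * X * (D * (M ∸ s * k))                         ≡⟨ solve 5 (λ p a x d y → p :* a :* x :* (d :* y) := a :* x :* d :* (p :* y)) refl (M ^ s) a X D (M ∸ s * k) ⟩
  a * X * D * (M ^ s * (M ∸ s * k))                         ≤⟨ *-monoʳ-≤ (a * X * D) (bernoulli M k s) ⟩
  a * X * D * ((M ∸ k) ^ s * M)                             ≡⟨ solve 5 (λ a x d p m → a :* x :* d :* (p :* m) := a :* d :* p :* x :* m) refl a X D ((M ∸ k) ^ s) M ⟩
  a * D * (M ∸ k) ^ s * X * M                               ≤⟨ *-monoˡ-≤ M h ⟩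
  (N + N) * M ^ s * (b * m) * M                             ≡⟨ solve 5 (λ n p b m l → (n :+ n) :* p :* (b :* m) :* l := con 2 :* m :* p :* (n :* (b :* l))) refl N (M ^ s) b m M ⟩
  2 * m * M ^ s * (N * (b * M))                             ∎)
  where
  open ≤-Reasoning
  open NatSolver
  M = suc m
  D = (m ∸ C) + (m ∸ C′)

square≤exp : ∀ s → s * s ≤ 2 * 2 ^ s
square≤exp 0 = z≤n
square≤exp 1 = s≤s z≤n
square≤exp 2 = s≤s (s≤s (s≤s (s≤s z≤n)))
square≤exp 3 = m≤m+n 9 7
-- The inequality `(s + 1)² ≤ 2 s²` holds from `s = 3` on, hence the separate small cases.
square≤exp (suc s@(suc (suc (suc t)))) = begin
  suc s * suc s                                 ≤⟨ m≤m+n _ (t * t + 4 * t + 2) ⟩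
  suc s * suc s + (t * t + 4 * t + 2)           ≡⟨ solve 1 (λ t → (con 4 :+ t) :* (con 4 :+ t) :+ (t :* t :+ con 4 :* t :+ con 2) := con 2 :* ((con 3 :+ t) :* (con 3 :+ t))) refl t ⟩
  2 * (s * s)                                   ≤⟨ *-monoʳ-≤ 2 (square≤exp s) ⟩
  2 * (2 * 2 ^ s)                               ∎
  where
  open ≤-Reasoning
  open NatSolver

errorBound : ℕ → ℕ
errorBound r = 24 * (q * q * q * q)
  where q = suc (suc r)

-- With `s = suc (d / suc r)` the degree is at most `s * q`, so `loss` is at most `12 q³ s²`,
-- whereas `den` is `q ^ s`. As `s² ≤ 2 * 2 ^ s`, the denominator absorbs the quadratic growth and
-- leaves a constant independent of `d`.
num*loss≤ : ∀ r d → num r d * loss r d ≤ errorBound r * den r d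
num*loss≤ r d = begin
  num r d * loss r d                         ≤⟨ *-mono-≤ (m∸n≤m q (d % suc r)) loss≤ ⟩
  q * (s * q * (12 * (s * (q * q))))         ≡⟨ solve 2 (λ q s → q :* (s :* q :* (con 12 :* (s :* (q :* q)))) := con 12 :* (q :* q :* q :* q) :* (s :* s)) refl q s ⟩
  12 * (q * q * q * q) * (s * s)             ≤⟨ *-monoʳ-≤ (12 * (q * q * q * q)) (≤-trans (square≤exp s) (*-monoʳ-≤ 2 (^-monoˡ-≤ s (s≤s (s≤s z≤n))))) ⟩
  12 * (q * q * q * q) * (2 * q ^ s)         ≡⟨ solve 2 (λ a b → con 12 :* a :* (con 2 :* b) := con 24 :* a :* b) refl (q * q * q * q) (q ^ s) ⟩
  errorBound r * q ^ s                       ∎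
  where
  open ≤-Reasoning
  open NatSolver
  q = suc (suc r)
  s = suc (d / suc r)
  d≤ : d ≤ s * q
  d≤ = begin
    d                                        ≡⟨ m≡m%n+[m/n]*n d (suc r) ⟩
    d % suc r + d / suc r * suc r            ≤⟨ +-monoˡ-≤ _ (<⇒≤ (m%n<n d (suc r))) ⟩
    s * suc r                                ≤⟨ *-monoʳ-≤ s (n≤1+n (suc r)) ⟩
    s * q                                    ∎
  K≤ : K r d ≤ 5 * (s * q)
  K≤ = begin
    3 * d + (3 + r)                          ≤⟨ +-mono-≤ (*-monoʳ-≤ 3 d≤) (m≤m+n (3 + r) (1 + r)) ⟩
    3 * (s * q) + (3 + r + (1 + r))          ≡⟨ cong (λ z → 3 * (s * q) + z) (solve 1 (λ r → con 3 :+ r :+ (con 1 :+ r) := con 2 :* (con 2 :+ r)) refl r) ⟩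
    3 * (s * q) + 2 * q                      ≤⟨ +-monoʳ-≤ (3 * (s * q)) (*-monoʳ-≤ 2 (m≤n*m q s)) ⟩
    3 * (s * q) + 2 * (s * q)                ≡⟨ sym (*-distribʳ-+ (s * q) 3 2) ⟩
    5 * (s * q)                              ∎
  loss≤ : loss r d ≤ s * q * (12 * (s * (q * q)))
  loss≤ = *-mono-≤ d≤ (begin
    2 + 2 * (suc r * K r d)                  ≤⟨ +-mono-≤ (*-monoʳ-≤ 2 (>-nonZero⁻¹ (s * (q * q)))) (*-monoʳ-≤ 2 (*-mono-≤ (n≤1+n (suc r)) K≤)) ⟩
    2 * (s * (q * q)) + 2 * (q * (5 * (s * q)))  ≡⟨ solve 2 (λ q s → con 2 :* (s :* (q :* q)) :+ con 2 :* (q :* (con 5 :* (s :* q))) := con 12 :* (s :* (q :* q))) refl q s ⟩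
    12 * (s * (q * q))                       ∎)

-- From inequalities between natural numbers to rationals.

module Difference (a b N T M m n : ℕ) (h : a * suc m * suc T ≤ N * suc b * suc m + M * suc b * suc T) (hn : M * M * n ≤ suc m * suc m) where
  open ℤ using (+_)

  private
    E D : ℚ
    E = frac M (suc m)
    D = frac a (suc b) ℚ.- frac N (suc T)

    raw : ∀ x y → toℚᵘ (frac x (suc y)) ℚᵘ.≃ mkℚᵘ (+ x) y
    raw x y = ℚP.toℚᵘ-fromℚᵘ (mkℚᵘ (+ x) y)

    sum-bound : frac a (suc b) ℚ.≤ E ℚ.+ frac N (suc T)
    sum-bound = ℚP.toℚᵘ-cancel-≤ (begin
      toℚᵘ (frac a (suc b))                        ≃⟨ raw a b ⟩
      mkℚᵘ (+ a) b                                 ≤⟨ *≤* core ⟩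
      mkℚᵘ (+ M) m ℚᵘ.+ mkℚᵘ (+ N) T               ≃⟨ ℚᵘP.≃-sym (ℚᵘP.≃-trans (ℚP.toℚᵘ-homo-+ E (frac N (suc T))) (ℚᵘP.+-cong (raw M m) (raw N T))) ⟩
      toℚᵘ (E ℚ.+ frac N (suc T))                  ∎)
      where
      open ℚᵘP.≤-Reasoning
      core : + a ℤ.* + (suc m * suc T) ℤ.≤ (+ M ℤ.* + suc T ℤ.+ + N ℤ.* + suc m) ℤ.* + suc b
      core = subst₂ ℤ._≤_ (ℤP.pos-* a (suc m * suc T))
        (trans (ℤP.pos-* (M * suc T + N * suc m) (suc b)) (cong (ℤ._* + suc b)
          (trans (ℤP.pos-+ (M * suc T) (N * suc m)) (cong₂ ℤ._+_ (ℤP.pos-* M (suc T)) (ℤP.pos-* N (suc m))))))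
        (ℤ.+≤+ (subst₂ _≤_ (*-assoc a (suc m) (suc T))
          (solve 5 (λ N b m M T → N :* b :* m :+ M :* b :* T := (M :* T :+ N :* m) :* b) refl N (suc b) (suc m) M (suc T)) h))
        where open NatSolver

    D≤E : D ℚ.≤ E
    D≤E = begin
      frac a (suc b) ℚ.- frac N (suc T)                    ≤⟨ ℚP.+-monoˡ-≤ (ℚ.- frac N (suc T)) sum-bound ⟩
      (E ℚ.+ frac N (suc T)) ℚ.- frac N (suc T)            ≡⟨ ℚP.+-assoc E _ _ ⟩
      E ℚ.+ (frac N (suc T) ℚ.- frac N (suc T))            ≡⟨ cong (E ℚ.+_) (ℚP.+-inverseʳ (frac N (suc T))) ⟩
      E ℚ.+ 0ℚ                                             ≡⟨ ℚP.+-identityʳ E ⟩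
      E                                                    ∎
      where open ℚP.≤-Reasoning

    E²n≤1 : E ℚ.* E ℚ.* ((+ n) ℚ./ 1) ℚ.≤ 1ℚ
    E²n≤1 = ℚP.toℚᵘ-cancel-≤ (begin
      toℚᵘ (E ℚ.* E ℚ.* ((+ n) ℚ./ 1))             ≃⟨ ℚᵘP.≃-trans (ℚP.toℚᵘ-homo-* (E ℚ.* E) _) (ℚᵘP.*-cong (ℚᵘP.≃-trans (ℚP.toℚᵘ-homo-* E E) (ℚᵘP.*-cong (raw M m) (raw M m))) (raw n 0)) ⟩
      mkℚᵘ (+ M) m ℚᵘ.* mkℚᵘ (+ M) m ℚᵘ.* mkℚᵘ (+ n) 0   ≤⟨ *≤* core ⟩
      toℚᵘ 1ℚ                                      ∎)
      where
      open ℚᵘP.≤-Reasoning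
      core : + M ℤ.* + M ℤ.* + n ℤ.* + 1 ℤ.≤ + 1 ℤ.* + (suc m * suc m * 1)
      core = subst₂ ℤ._≤_
        (trans (trans (ℤP.pos-* (M * M) n) (cong (ℤ._* + n) (ℤP.pos-* M M))) (sym (ℤP.*-identityʳ _)))
        (trans (cong +_ (sym (*-identityʳ (suc m * suc m)))) (sym (ℤP.*-identityˡ _))) (ℤ.+≤+ hn)

  atMostInvRoot : AtMostInvRoot 2 n (frac a (suc b) ℚ.- frac N (suc T))
  atMostInvRoot with D ℚP.≤? 0ℚ
  ... | yes D≤0 = inj₁ D≤0
  ... | no D≰0  = inj₂ (begin
    D ℚ.* (D ℚ.* 1ℚ) ℚ.* ((+ n) ℚ./ 1)     ≡⟨ cong (λ z → D ℚ.* z ℚ.* ((+ n) ℚ./ 1)) (ℚP.*-identityʳ D) ⟩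
    D ℚ.* D ℚ.* ((+ n) ℚ./ 1)              ≤⟨ ℚP.*-monoʳ-≤-nonNeg ((+ n) ℚ./ 1) {{ℚP.normalize-nonNeg n 1}} D²≤E² ⟩
    E ℚ.* E ℚ.* ((+ n) ℚ./ 1)              ≤⟨ E²n≤1 ⟩
    1ℚ                                     ∎)
    where
    open ℚP.≤-Reasoning
    0≤D : 0ℚ ℚ.≤ D
    0≤D = ℚP.<⇒≤ (ℚP.≰⇒> D≰0)
    D²≤E² : D ℚ.* D ℚ.≤ E ℚ.* E
    D²≤E² = ℚP.≤-trans (ℚP.*-monoˡ-≤-nonNeg D {{ℚ.nonNegative 0≤D}} D≤E)
      (ℚP.*-monoʳ-≤-nonNeg E {{ℚ.nonNegative (ℚP.≤-trans 0≤D D≤E)}} D≤E)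

-- The last two hypotheses are `a/b ≤ N/T + M/m` and `(M/m)² n ≤ 1`, cleared of denominators. A
-- positive difference is at most `M/m` and can be squared; any other falls under the first
-- alternative of `AtMostInvRoot`.
difference≤invRoot : ∀ a {b} N {T} M {m} n → 0 < b → 0 < T → 0 < m → a * m * T ≤ N * b * m + M * b * T → M * M * n ≤ m * m →
  AtMostInvRoot 2 n (frac a b ℚ.- frac N T)
difference≤invRoot a {suc b} N {suc T} M {suc m} n _ _ _ = Difference.atMostInvRoot a b N T M m n

-- Finite fields and functions of one variable.

module OverField (F : FiniteField) where

  private variable
    n : ℕ

  open FiniteField F public renaming (_+_ to _⊕_; _*_ to _⊗_; -_ to ⊖_)

  ring : CommutativeRing 0ℓ 0ℓ
  ring = record { isCommutativeRing = isCommutativeRing }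

  open CommutativeRing ring public using () renaming
    ( +-assoc to ⊕-assoc; +-comm to ⊕-comm; +-identityˡ to ⊕-identityˡ; +-identityʳ to ⊕-identityʳ
    ; *-assoc to ⊗-assoc; *-comm to ⊗-comm; *-identityˡ to ⊗-identityˡ; *-identityʳ to ⊗-identityʳ
    ; distribˡ to ⊗-distribˡ; zeroˡ to ⊗-zeroˡ; zeroʳ to ⊗-zeroʳ
    ; -‿inverseˡ to ⊖-inverseˡ; -‿inverseʳ to ⊖-inverseʳ)

  module FieldSolver = RingSolver (CommutativeRing.commutativeSemiring ring)

  _⊝_ : Carrier → Carrier → Carrier
  x ⊝ y = x ⊕ (⊖ y)

  ⊝-⊕ : ∀ x y → (x ⊝ y) ⊕ y ≡ x
  ⊝-⊕ x y = trans (⊕-assoc x (⊖ y) y) (trans (cong (x ⊕_) (⊖-inverseˡ y)) (⊕-identityʳ x))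

  ⊕-⊝ : ∀ x y → y ⊕ (x ⊝ y) ≡ x
  ⊕-⊝ x y = trans (⊕-comm y _) (⊝-⊕ x y)

  ⊝-self-⊗ : ∀ x y → (x ⊝ x) ⊗ y ≡ 0#
  ⊝-self-⊗ x y = trans (cong (_⊗ y) (⊖-inverseʳ x)) (⊗-zeroˡ y)

  ⊝≡0⇒≡ : ∀ x y → x ⊝ y ≡ 0# → x ≡ y
  ⊝≡0⇒≡ x y e = trans (sym (⊝-⊕ x y)) (trans (cong (_⊕ y) e) (⊕-identityˡ y))

  ⊕-cancelˡ : ∀ x {y z} → x ⊕ y ≡ x ⊕ z → y ≡ z
  ⊕-cancelˡ x {y} {z} = GroupProperties.∙-cancelˡ (CommutativeRing.+-group ring) x y z

  noZeroDivisors : ∀ x y → x ⊗ y ≡ 0# → x ≢ 0# → y ≡ 0#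
  noZeroDivisors x y xy≡0 x≢0 with inverse x x≢0
  ... | z , xz≡1 = begin
    y             ≡⟨ sym (⊗-identityˡ y) ⟩
    1# ⊗ y        ≡⟨ cong (_⊗ y) (trans (sym xz≡1) (⊗-comm x z)) ⟩
    (z ⊗ x) ⊗ y   ≡⟨ ⊗-assoc z x y ⟩
    z ⊗ (x ⊗ y)   ≡⟨ cong (z ⊗_) xy≡0 ⟩
    z ⊗ 0#        ≡⟨ ⊗-zeroʳ z ⟩
    0#            ∎
    where open ≡-Reasoning

  -- A Horner form with arbitrary centres attaches a formal degree and a leading coefficient `l` to
  -- a function on the field, where distinct polynomials may define the same function.
  data HasDegree (l : Carrier) : ℕ → (Carrier → Carrier) → Set where
    constant : ∀ {g} → (∀ y → g y ≡ l) → HasDegree l 0 g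
    step     : ∀ {j g h} c s → HasDegree l j h → (∀ y → g y ≡ c ⊕ ((y ⊝ s) ⊗ h y)) → HasDegree l (suc j) g

  -- Division by `y - r` with remainder `g r`. Rewriting `y - s` as `(y - r) + (r - s)` moves the
  -- centre, and the quotient keeps the leading coefficient, so roots can be split off one by one.
  divide : ∀ {l j g} → HasDegree l (suc j) g → ∀ r →
    ∃[ h ] (HasDegree l j h × (∀ y → g y ≡ g r ⊕ ((y ⊝ r) ⊗ h y)))
  divide {l} {_} {g} (step {h = h} c s (constant e) eq) r = (λ _ → l) , constant (λ _ → refl) , λ y → begin
    g y                                     ≡⟨ trans (eq y) (cong (λ z → c ⊕ ((y ⊝ s) ⊗ z)) (e y)) ⟩
    c ⊕ ((y ⊝ s) ⊗ l)                       ≡⟨ cong (λ z → c ⊕ (z ⊗ l)) (split y) ⟩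
    c ⊕ (((y ⊝ r) ⊕ (r ⊝ s)) ⊗ l)           ≡⟨ solve 4 (λ c a b l → c :+ (a :+ b) :* l := (c :+ b :* l) :+ a :* l) refl c (y ⊝ r) (r ⊝ s) l ⟩
    (c ⊕ ((r ⊝ s) ⊗ l)) ⊕ ((y ⊝ r) ⊗ l)     ≡⟨ cong (_⊕ ((y ⊝ r) ⊗ l)) (sym (trans (eq r) (cong (λ z → c ⊕ ((r ⊝ s) ⊗ z)) (e r)))) ⟩
    g r ⊕ ((y ⊝ r) ⊗ l)                     ∎
    where
    open ≡-Reasoning
    open FieldSolver
    split : ∀ y → y ⊝ s ≡ (y ⊝ r) ⊕ (r ⊝ s)
    split y = sym (trans (sym (⊕-assoc (y ⊝ r) r (⊖ s))) (cong (_⊕ (⊖ s)) (⊝-⊕ y r)))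
  divide {l} {_} {g} (step {h = h} c s hd@(step _ _ _ _) eq) r with divide hd r
  ... | k , kd , keq = (λ y → h r ⊕ ((y ⊝ s) ⊗ k y)) , step (h r) s kd (λ _ → refl) , λ y → begin
    g y
      ≡⟨ trans (eq y) (cong (λ z → c ⊕ ((y ⊝ s) ⊗ z)) (keq y)) ⟩
    c ⊕ ((y ⊝ s) ⊗ (h r ⊕ ((y ⊝ r) ⊗ k y)))
      ≡⟨ solve 5 (λ c a b d k → c :+ a :* (b :+ d :* k) := (c :+ a :* b) :+ d :* (a :* k)) refl c (y ⊝ s) (h r) (y ⊝ r) (k y) ⟩
    (c ⊕ ((y ⊝ s) ⊗ h r)) ⊕ ((y ⊝ r) ⊗ ((y ⊝ s) ⊗ k y))
      ≡⟨ cong (λ z → (c ⊕ (z ⊗ h r)) ⊕ ((y ⊝ r) ⊗ ((y ⊝ s) ⊗ k y))) (split y) ⟩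
    (c ⊕ (((y ⊝ r) ⊕ (r ⊝ s)) ⊗ h r)) ⊕ ((y ⊝ r) ⊗ ((y ⊝ s) ⊗ k y))
      ≡⟨ solve 5 (λ c a b h e → (c :+ (a :+ b) :* h) :+ a :* e := (c :+ b :* h) :+ a :* (h :+ e)) refl c (y ⊝ r) (r ⊝ s) (h r) ((y ⊝ s) ⊗ k y) ⟩
    (c ⊕ ((r ⊝ s) ⊗ h r)) ⊕ ((y ⊝ r) ⊗ (h r ⊕ ((y ⊝ s) ⊗ k y)))
      ≡⟨ cong (_⊕ ((y ⊝ r) ⊗ (h r ⊕ ((y ⊝ s) ⊗ k y)))) (sym (eq r)) ⟩
    g r ⊕ ((y ⊝ r) ⊗ (h r ⊕ ((y ⊝ s) ⊗ k y))) ∎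
    where
    open ≡-Reasoning
    open FieldSolver
    split : ∀ y → y ⊝ s ≡ (y ⊝ r) ⊕ (r ⊝ s)
    split y = sym (trans (sym (⊕-assoc (y ⊝ r) r (⊖ s))) (cong (_⊕ (⊖ s)) (⊝-⊕ y r)))

  roots≤degree : ∀ {l j g} → l ≢ 0# → HasDegree l j g → ∀ {ys} → Unique ys → All (λ y → g y ≡ 0#) ys → length ys ≤ j
  roots≤degree l≢0 hd [] [] = z≤n
  roots≤degree l≢0 (constant e) (_ ∷ _) (z ∷ _) = ⊥-elim (l≢0 (trans (sym (e _)) z))
  roots≤degree {g = g} l≢0 hd@(step _ _ _ _) {r ∷ _} (r∉ ∷ u) (gr ∷ zs) with divide hd r
  ... | h , hdeg , eq = s≤s (roots≤degree l≢0 hdeg u (All.zipWith root (r∉ , zs)))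
    where
    root : ∀ {y} → r ≢ y × g y ≡ 0# → h y ≡ 0#
    root {y} (r≢y , gy) = noZeroDivisors (y ⊝ r) (h y)
      (trans (sym (⊕-identityˡ _)) (trans (cong (_⊕ _) (sym gr)) (trans (sym (eq y)) gy)))
      (λ e → r≢y (sym (⊝≡0⇒≡ y r e)))

  nonroots : ∀ {l j g} → l ≢ 0# → HasDegree l j g → card ∸ j ≤ ∑ elems (λ y → ⟦ ¬? (g y ≟ 0#) ⟧)
  nonroots {j = j} {g} l≢0 hd = m≤n+o⇒m∸n≤o card j (begin
    card                                                  ≡⟨ sym (∑-one elems) ⟩
    ∑ elems (λ _ → 1)                                     ≡⟨ ∑-cong elems (λ y → sym (trans (+-comm ⟦ g y ≟ 0# ⟧ _) (⟦¬⟧ (g y ≟ 0#)))) ⟩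
    ∑ elems (λ y → ⟦ g y ≟ 0# ⟧ + ⟦ ¬? (g y ≟ 0#) ⟧)      ≡⟨ ∑-+ elems _ _ ⟩
    ∑ elems (λ y → ⟦ g y ≟ 0# ⟧) + ∑ elems (λ y → ⟦ ¬? (g y ≟ 0#) ⟧)
      ≤⟨ +-monoˡ-≤ _ (subst (_≤ j) (length-filter-∑ root? elems)
           (roots≤degree l≢0 hd (Uniq.filter⁺ root? unique) (AllP.all-filter root? elems))) ⟩
    j + ∑ elems (λ y → ⟦ ¬? (g y ≟ 0#) ⟧) ∎)
    where
    open ≤-Reasoning
    root? : ∀ y → Dec (g y ≡ 0#)
    root? y = g y ≟ 0#

  -- Newton expansions.

  -- The polynomial Σᵢ cᵢ (y - s₀)⋯(y - sᵢ₋₁), in Horner form.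
  newton : List Carrier → (ℕ → Carrier) → Carrier → Carrier
  newton []       c y = 0#
  newton (s ∷ ss) c y = c 0 ⊕ ((y ⊝ s) ⊗ newton ss (λ i → c (suc i)) y)

  newton-zero : ∀ ss c y → (∀ i → i < length ss → c i ≡ 0#) → newton ss c y ≡ 0#
  newton-zero []       c y z = refl
  newton-zero (s ∷ ss) c y z = trans
    (cong₂ _⊕_ (z 0 (s≤s z≤n)) (trans (cong ((y ⊝ s) ⊗_) (newton-zero ss _ y (λ i i< → z (suc i) (s≤s i<)))) (⊗-zeroʳ _)))
    (⊕-identityʳ 0#)

  newton-constant : ∀ s ss c y → (∀ i → 0 < i → i < suc (length ss) → c i ≡ 0#) → newton (s ∷ ss) c y ≡ c 0
  newton-constant s ss c y z = trans
    (cong (c 0 ⊕_) (trans (cong ((y ⊝ s) ⊗_) (newton-zero ss _ y (λ i i< → z (suc i) (s≤s z≤n) (s≤s i<)))) (⊗-zeroʳ _)))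
    (⊕-identityʳ (c 0))

  newton-degree : ∀ ss c j → j < length ss → (∀ i → j < i → i < length ss → c i ≡ 0#) → HasDegree (c j) j (newton ss c)
  newton-degree (s ∷ ss) c zero    _        z = constant (λ y → newton-constant s ss c y z)
  newton-degree (s ∷ ss) c (suc j) (s≤s j<) z = step (c 0) s
    (newton-degree ss (λ i → c (suc i)) j j< (λ i j<i i< → z (suc i) (s≤s j<i) (s≤s i<))) (λ _ → refl)

  -- Coefficients of k + (y + σ) · newton ss c y: since
  -- (y + σ)(y - s₀)⋯(y - sᵢ₋₁) = (y - s₀)⋯(y - sᵢ) + (σ + sᵢ)(y - s₀)⋯(y - sᵢ₋₁)
  -- and the full product over the nodes vanishes at every node, no reduction modulo y^q - y is needed.
  shiftMul : List Carrier → Carrier → Carrier → (ℕ → Carrier) → ℕ → Carrier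
  shiftMul []       σ k c i       = 0#
  shiftMul (s ∷ ss) σ k c zero    = k ⊕ ((σ ⊕ s) ⊗ c 0)
  shiftMul (s ∷ ss) σ k c (suc i) = shiftMul ss σ (c 0) (λ i → c (suc i)) i

  -- The recursion stops at the node equal to `y`, where the factor `s ⊝ s` kills everything deeper,
  -- including the dropped top product.
  newton-shiftMul : ∀ ss σ k c y → y ∈ ss → newton ss (shiftMul ss σ k c) y ≡ k ⊕ ((y ⊕ σ) ⊗ newton ss c y)
  newton-shiftMul (s ∷ ss) σ k c .s (here refl) = begin
    (k ⊕ ((σ ⊕ s) ⊗ c 0)) ⊕ ((s ⊝ s) ⊗ _)   ≡⟨ cong ((k ⊕ ((σ ⊕ s) ⊗ c 0)) ⊕_) (⊝-self-⊗ s _) ⟩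
    (k ⊕ ((σ ⊕ s) ⊗ c 0)) ⊕ 0#              ≡⟨ solve 4 (λ k σ s c → k :+ (σ :+ s) :* c :+ con 0 := k :+ (s :+ σ) :* (c :+ con 0)) refl k σ s (c 0) ⟩
    k ⊕ ((s ⊕ σ) ⊗ (c 0 ⊕ 0#))              ≡⟨ cong (λ z → k ⊕ ((s ⊕ σ) ⊗ (c 0 ⊕ z))) (sym (⊝-self-⊗ s _)) ⟩
    k ⊕ ((s ⊕ σ) ⊗ (c 0 ⊕ ((s ⊝ s) ⊗ newton ss (λ i → c (suc i)) s))) ∎
    where
    open ≡-Reasoning
    open FieldSolver
  newton-shiftMul (s ∷ ss) σ k c y (there y∈) = begin
    (k ⊕ ((σ ⊕ s) ⊗ c 0)) ⊕ (a ⊗ newton ss (shiftMul ss σ (c 0) (λ i → c (suc i))) y)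
      ≡⟨ cong (λ z → (k ⊕ ((σ ⊕ s) ⊗ c 0)) ⊕ (a ⊗ z)) (newton-shiftMul ss σ (c 0) _ y y∈) ⟩
    (k ⊕ ((σ ⊕ s) ⊗ c 0)) ⊕ (a ⊗ (c 0 ⊕ ((y ⊕ σ) ⊗ N)))
      ≡⟨ cong (λ z → (k ⊕ ((σ ⊕ s) ⊗ c 0)) ⊕ (a ⊗ (c 0 ⊕ ((z ⊕ σ) ⊗ N)))) (sym (⊝-⊕ y s)) ⟩
    (k ⊕ ((σ ⊕ s) ⊗ c 0)) ⊕ (a ⊗ (c 0 ⊕ (((a ⊕ s) ⊕ σ) ⊗ N)))
      ≡⟨ solve 6 (λ k σ s c a N → (k :+ (σ :+ s) :* c) :+ a :* (c :+ (a :+ s :+ σ) :* N)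
                               := k :+ (a :+ s :+ σ) :* (c :+ a :* N)) refl k σ s (c 0) a N ⟩
    k ⊕ (((a ⊕ s) ⊕ σ) ⊗ (c 0 ⊕ (a ⊗ N)))
      ≡⟨ cong (λ z → k ⊕ ((z ⊕ σ) ⊗ (c 0 ⊕ (a ⊗ N)))) (⊝-⊕ y s) ⟩
    k ⊕ ((y ⊕ σ) ⊗ (c 0 ⊕ (a ⊗ N))) ∎
    where
    open ≡-Reasoning
    open FieldSolver
    a = y ⊝ s
    N = newton ss (λ i → c (suc i)) y

  newton-scale : ∀ ss k c y → newton ss (λ i → k ⊗ c i) y ≡ k ⊗ newton ss c y
  newton-scale []       k c y = sym (⊗-zeroʳ k)
  newton-scale (s ∷ ss) k c y rewrite newton-scale ss k (λ i → c (suc i)) y =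
    solve 4 (λ k c a N → k :* c :+ a :* (k :* N) := k :* (c :+ a :* N)) refl k (c 0) (y ⊝ s) (newton ss (λ i → c (suc i)) y)
    where open FieldSolver

  newton-add : ∀ ss c c′ y → newton ss (λ i → c i ⊕ c′ i) y ≡ newton ss c y ⊕ newton ss c′ y
  newton-add []       c c′ y = sym (⊕-identityʳ 0#)
  newton-add (s ∷ ss) c c′ y rewrite newton-add ss (λ i → c (suc i)) (λ i → c′ (suc i)) y =
    solve 5 (λ c d a N M → (c :+ d) :+ a :* (N :+ M) := (c :+ a :* N) :+ (d :+ a :* M)) refl
      (c 0) (c′ 0) (y ⊝ s) (newton ss (λ i → c (suc i)) y) (newton ss (λ i → c′ (suc i)) y)
    where open FieldSolver

  -- Functions of bounded degree.

  Fun : ℕ → Set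
  Fun n = Vec Carrier n → Carrier

  -- Deg D f: f is a polynomial function of degree strictly less than D (so Deg 0 f means f = 0).
  data Deg {n : ℕ} : ℕ → Fun n → Set where
    zeroᵈ  : ∀ {D f} → (∀ x → f x ≡ 0#) → Deg D f
    constᵈ : ∀ {D f} c → (∀ x → f x ≡ c) → Deg (suc D) f
    addᵈ   : ∀ {D f g h} → Deg D g → Deg D h → (∀ x → f x ≡ g x ⊕ h x) → Deg D f
    varᵈ   : ∀ {D f g} i → Deg D g → (∀ x → f x ≡ lookup x i ⊗ g x) → Deg (suc D) f

  Deg0⇒≡0 : ∀ {f : Fun n} → Deg 0 f → ∀ x → f x ≡ 0#
  Deg0⇒≡0 (zeroᵈ e)    x = e x
  Deg0⇒≡0 (addᵈ g h e) x = trans (e x) (trans (cong₂ _⊕_ (Deg0⇒≡0 g x) (Deg0⇒≡0 h x)) (⊕-identityʳ 0#))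

  Deg-mono : ∀ {D D′} {f : Fun n} → D ≤ D′ → Deg D f → Deg D′ f
  Deg-mono le       (zeroᵈ e)    = zeroᵈ e
  Deg-mono (s≤s le) (constᵈ c e) = constᵈ c e
  Deg-mono le       (addᵈ g h e) = addᵈ (Deg-mono le g) (Deg-mono le h) e
  Deg-mono (s≤s le) (varᵈ i g e) = varᵈ i (Deg-mono le g) e

  Deg-scale : ∀ {D} {f : Fun n} c → Deg D f → Deg D (λ x → c ⊗ f x)
  Deg-scale c (zeroᵈ e)     = zeroᵈ (λ x → trans (cong (c ⊗_) (e x)) (⊗-zeroʳ c))
  Deg-scale c (constᵈ c′ e) = constᵈ (c ⊗ c′) (λ x → cong (c ⊗_) (e x))
  Deg-scale c (addᵈ g h e)  = addᵈ (Deg-scale c g) (Deg-scale c h) (λ x → trans (cong (c ⊗_) (e x)) (⊗-distribˡ c _ _))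
  Deg-scale c (varᵈ i g e)  = varᵈ i (Deg-scale c g) (λ x → trans (cong (c ⊗_) (e x))
    (solve 3 (λ c a g → c :* (a :* g) := a :* (c :* g)) refl c (lookup x i) _))
    where open FieldSolver

  -- For `i > D` the truncated bound stays 0, and the product is still zero because `f` is.
  Deg-var∸ : ∀ D i {f : Fun n} l → Deg (D ∸ i) f → Deg (suc D ∸ i) (λ x → lookup x l ⊗ f x)
  Deg-var∸ D       zero    l df = varᵈ l df (λ _ → refl)
  Deg-var∸ zero    (suc i) l df = zeroᵈ (λ x → trans (cong (lookup x l ⊗_) (Deg0⇒≡0 df x)) (⊗-zeroʳ _))
  Deg-var∸ (suc D) (suc i) l df = Deg-var∸ D i l df

  Deg-substitute : ∀ {D} {f : Fun n} (φ : Vec Carrier n → Vec Carrier n) →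
    (∀ l → (∃[ c ] (∀ x → lookup (φ x) l ≡ c)) ⊎ (∀ x → lookup (φ x) l ≡ lookup x l)) →
    Deg D f → Deg D (λ x → f (φ x))
  Deg-substitute φ s (zeroᵈ e)    = zeroᵈ (λ x → e (φ x))
  Deg-substitute φ s (constᵈ c e) = constᵈ c (λ x → e (φ x))
  Deg-substitute φ s (addᵈ g h e) = addᵈ (Deg-substitute φ s g) (Deg-substitute φ s h) (λ x → e (φ x))
  Deg-substitute φ s (varᵈ {D} {g = g} l dg e) with s l
  ... | inj₁ (c , ec) = Deg-mono (n≤1+n D) (addᵈ (Deg-scale c (Deg-substitute φ s dg)) (zeroᵈ (λ _ → refl))
          (λ x → trans (e (φ x)) (trans (cong (_⊗ g (φ x)) (ec x)) (sym (⊕-identityʳ _)))))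
  ... | inj₂ el = varᵈ l (Deg-substitute φ s dg) (λ x → trans (e (φ x)) (cong (_⊗ g (φ x)) (el x)))

  -- A discrete derivative. A monomial without a fixed coordinate takes the same value under `φ` and
  -- `ψ`, and one with a fixed coordinate has lost a degree by the substitution.
  Deg-difference : ∀ {D} {f : Fun n} (φ ψ : Vec Carrier n → Vec Carrier n) →
    (∀ l → (∃[ c ] ∃[ c′ ] (∀ x → lookup (φ x) l ≡ c × lookup (ψ x) l ≡ c′))
         ⊎ (∀ x → lookup (φ x) l ≡ lookup x l × lookup (ψ x) l ≡ lookup x l)) →
    Deg D f → ∃[ h ] (Deg (D ∸ 1) h × (∀ x → f (φ x) ≡ f (ψ x) ⊕ h x))
  Deg-difference φ ψ s (zeroᵈ e)    = (λ _ → 0#) , zeroᵈ (λ _ → refl) ,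
    λ x → trans (e (φ x)) (sym (trans (⊕-identityʳ _) (e (ψ x))))
  Deg-difference φ ψ s (constᵈ c e) = (λ _ → 0#) , zeroᵈ (λ _ → refl) ,
    λ x → trans (e (φ x)) (sym (trans (⊕-identityʳ _) (e (ψ x))))
  Deg-difference {f = f} φ ψ s (addᵈ {g = g} {h} dg dh e) with Deg-difference φ ψ s dg | Deg-difference φ ψ s dh
  ... | g′ , dg′ , eg | h′ , dh′ , eh = (λ x → g′ x ⊕ h′ x) , addᵈ dg′ dh′ (λ _ → refl) , λ x → begin
    f (φ x)                                       ≡⟨ trans (e (φ x)) (cong₂ _⊕_ (eg x) (eh x)) ⟩
    (g (ψ x) ⊕ g′ x) ⊕ (h (ψ x) ⊕ h′ x)           ≡⟨ solve 4 (λ a b c d → (a :+ b) :+ (c :+ d) := (a :+ c) :+ (b :+ d)) refl (g (ψ x)) (g′ x) (h (ψ x)) (h′ x) ⟩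
    (g (ψ x) ⊕ h (ψ x)) ⊕ (g′ x ⊕ h′ x)           ≡⟨ cong (_⊕ _) (sym (e (ψ x))) ⟩
    f (ψ x) ⊕ (g′ x ⊕ h′ x)                       ∎
    where
    open ≡-Reasoning
    open FieldSolver
  Deg-difference {f = f} φ ψ s (varᵈ {D} {g = g} l dg e) with s l | Deg-difference φ ψ s dg
  ... | inj₂ el | g′ , dg′ , eg = (λ x → lookup x l ⊗ g′ x) , Deg-var∸ D 1 l dg′ , λ x → begin
    f (φ x)                                        ≡⟨ trans (e (φ x)) (cong₂ _⊗_ (proj₁ (el x)) (eg x)) ⟩
    lookup x l ⊗ (g (ψ x) ⊕ g′ x)                  ≡⟨ ⊗-distribˡ _ _ _ ⟩
    (lookup x l ⊗ g (ψ x)) ⊕ (lookup x l ⊗ g′ x)   ≡⟨ cong (_⊕ _) (sym (trans (e (ψ x)) (cong (_⊗ g (ψ x)) (proj₂ (el x))))) ⟩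
    f (ψ x) ⊕ (lookup x l ⊗ g′ x)                  ∎
    where open ≡-Reasoning
  -- The product rule: `c g(φ) = c′ g(ψ) + (c - c′) g(ψ) + c g′`. The factor in front is now a
  -- constant, so both correction terms stay within the degree of `g`.
  ... | inj₁ (c , c′ , ec) | g′ , dg′ , eg =
    (λ x → ((c ⊝ c′) ⊗ g (ψ x)) ⊕ (c ⊗ g′ x)) ,
    addᵈ (Deg-scale (c ⊝ c′) (Deg-substitute ψ const-or-var dg)) (Deg-scale c (Deg-mono (m∸n≤m D 1) dg′)) (λ _ → refl) , λ x → begin
    f (φ x)                                                   ≡⟨ trans (e (φ x)) (cong₂ _⊗_ (proj₁ (ec x)) (eg x)) ⟩
    c ⊗ (g (ψ x) ⊕ g′ x)                                      ≡⟨ ⊗-distribˡ _ _ _ ⟩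
    (c ⊗ g (ψ x)) ⊕ (c ⊗ g′ x)                                ≡⟨ cong (λ z → (z ⊗ g (ψ x)) ⊕ (c ⊗ g′ x)) (sym (⊝-⊕ c c′)) ⟩
    (((c ⊝ c′) ⊕ c′) ⊗ g (ψ x)) ⊕ (c ⊗ g′ x)                  ≡⟨ solve 4 (λ a c′ g h → (a :+ c′) :* g :+ h := c′ :* g :+ (a :* g :+ h)) refl (c ⊝ c′) c′ (g (ψ x)) (c ⊗ g′ x) ⟩
    (c′ ⊗ g (ψ x)) ⊕ (((c ⊝ c′) ⊗ g (ψ x)) ⊕ (c ⊗ g′ x))      ≡⟨ cong (_⊕ _) (sym (trans (e (ψ x)) (cong (_⊗ g (ψ x)) (proj₂ (ec x))))) ⟩
    f (ψ x) ⊕ (((c ⊝ c′) ⊗ g (ψ x)) ⊕ (c ⊗ g′ x))             ∎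
    where
    open ≡-Reasoning
    open FieldSolver
    const-or-var : ∀ l → (∃[ c ] (∀ x → lookup (ψ x) l ≡ c)) ⊎ (∀ x → lookup (ψ x) l ≡ lookup x l)
    const-or-var l with s l
    ... | inj₁ (_ , c′ , ec) = inj₁ (c′ , λ x → proj₂ (ec x))
    ... | inj₂ el            = inj₂ (λ x → proj₂ (el x))

  -- An abstract decreasing family lets the recursion pass to `λ i → E (suc i)`; the instance of
  -- interest is `Deg (suc D ∸ i)`.
  shiftMul-closed : (E : ℕ → Fun n → Set) →
    (∀ {i} → E i (λ _ → 0#)) → (∀ {i f} c → E i f → E i (λ x → c ⊗ f x)) →
    (∀ {i f g} → E i f → E i g → E i (λ x → f x ⊕ g x)) → (∀ {i f} → E (suc i) f → E i f) →
    ∀ ss σ k (c : ℕ → Fun n) → E 0 k → (∀ i → E (suc i) (c i)) →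
    ∀ i → E i (λ x → shiftMul ss σ (k x) (λ i → c i x) i)
  shiftMul-closed E z sc ad dn []       σ k c Ek Ec i       = z
  shiftMul-closed E z sc ad dn (s ∷ ss) σ k c Ek Ec zero    = ad Ek (sc (σ ⊕ s) (dn (Ec 0)))
  shiftMul-closed E z sc ad dn (s ∷ ss) σ k c Ek Ec (suc i) =
    shiftMul-closed (λ i → E (suc i)) z sc ad dn ss σ (c 0) (λ i → c (suc i)) (Ec 0) (λ i → Ec (suc i)) i

  -- A coordinate on the line multiplies by `y + σ` and acts through `shiftMul`; any other
  -- coordinate multiplies each coefficient. Either way the degree bound on `c i` grows by one,
  -- along with that on `f`.
  newton-expansion : ∀ {D} {f : Fun n} (φ : Carrier → Vec Carrier n → Vec Carrier n) →
    (∀ l → (∃[ σ ] (∀ y x → lookup (φ y x) l ≡ y ⊕ σ)) ⊎ (∀ y x → lookup (φ y x) l ≡ lookup x l)) →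
    Deg D f → ∃[ c ] ((∀ i → Deg (D ∸ i) (c i)) × (∀ y x → f (φ y x) ≡ newton elems (λ i → c i x) y))
  newton-expansion φ s (zeroᵈ e) = (λ _ _ → 0#) , (λ i → zeroᵈ (λ _ → refl)) ,
    λ y x → trans (e (φ y x)) (sym (newton-zero elems _ y (λ _ _ → refl)))
  newton-expansion {n} {f = f} φ s (constᵈ {D} k e) = c , dc , λ y x → trans (e (φ y x)) (expand (nonempty y) y x)
    where
    c : ℕ → Fun n
    c zero    x = k
    c (suc i) x = 0#
    dc : ∀ i → Deg (suc D ∸ i) (c i)
    dc zero    = constᵈ k (λ _ → refl)
    dc (suc i) = zeroᵈ (λ _ → refl)
    -- An empty list of nodes would make `newton` zero; the point `y` itself shows that `elems` is
    -- nonempty.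
    nonempty : Carrier → ∃[ s ] ∃[ ss ] (elems ≡ s ∷ ss)
    nonempty y with elems | complete y
    ... | s ∷ ss | _ = s , ss , refl
    expand : (∃[ s ] ∃[ ss ] (elems ≡ s ∷ ss)) → ∀ y x → k ≡ newton elems (λ i → c i x) y
    expand (s , ss , eq) y x rewrite eq = sym (newton-constant s ss (λ i → c i x) y (λ { (suc i) _ _ → refl }))
  newton-expansion φ s (addᵈ dg dh e) with newton-expansion φ s dg | newton-expansion φ s dh
  ... | c , dc , ec | c′ , dc′ , ec′ = (λ i x → c i x ⊕ c′ i x) , (λ i → addᵈ (dc i) (dc′ i) (λ _ → refl)) ,
    λ y x → trans (e (φ y x)) (trans (cong₂ _⊕_ (ec y x) (ec′ y x)) (sym (newton-add elems _ _ y)))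
  newton-expansion φ s (varᵈ {D} {g = g} l dg e) with s l | newton-expansion φ s dg
  ... | inj₂ el | c , dc , ec = (λ i x → lookup x l ⊗ c i x) , (λ i → Deg-var∸ D i l (dc i)) ,
    λ y x → trans (e (φ y x)) (trans (cong₂ _⊗_ (el y x) (ec y x)) (sym (newton-scale elems _ _ y)))
  ... | inj₁ (σ , eσ) | c , dc , ec = (λ i x → shiftMul elems σ 0# (λ i → c i x) i) ,
    shiftMul-closed (λ i → Deg (suc D ∸ i)) (zeroᵈ (λ _ → refl)) Deg-scale (λ a b → addᵈ a b (λ _ → refl))
      (λ {i} → Deg-mono (∸-monoʳ-≤ (suc D) (n≤1+n i))) elems σ (λ _ → 0#) c (zeroᵈ (λ _ → refl)) dc ,
    λ y x → trans (e (φ y x)) (trans (cong₂ _⊗_ (eσ y x) (ec y x))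
      (sym (trans (newton-shiftMul elems σ 0# _ y (complete y)) (⊕-identityˡ _))))

  -- Assignments and balanced slices with frozen coordinates.

  _∈?_ : (r : Fin n) (L : List (Fin n)) → Dec (r ∈ L)
  _∈?_ = DecMembership._∈?_ FinP._≟_

  lookup-ext : ∀ {x y : Vec Carrier n} → (∀ i → lookup x i ≡ lookup y i) → x ≡ y
  lookup-ext {x = x} {y} e = trans (sym (VecP.tabulate∘lookup x)) (trans (VecP.tabulate-cong e) (VecP.tabulate∘lookup y))

  Assignment : ℕ → Set
  Assignment n = List (Fin n × Carrier)

  dom : Assignment n → List (Fin n)
  dom = map proj₁

  put : Assignment n → Vec Carrier n → Vec Carrier n
  put []             x = x
  put ((r , v) ∷ ps) x = put ps x [ r ]≔ v

  Agrees : Vec Carrier n → Assignment n → Set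
  Agrees x = All (λ (r , v) → lookup x r ≡ v)

  lookup-put-∉ : ∀ ps (x : Vec Carrier n) {l} → l ∉ dom ps → lookup (put ps x) l ≡ lookup x l
  lookup-put-∉ []             x l∉ = refl
  lookup-put-∉ ((r , v) ∷ ps) x {l} l∉ = trans (VecP.lookup∘update′ (λ e → l∉ (here e)) (put ps x) v)
    (lookup-put-∉ ps x (l∉ ∘ there))

  put-agrees : ∀ ps (x : Vec Carrier n) → Unique (dom ps) → Agrees (put ps x) ps
  put-agrees []             x u = []
  put-agrees ((r , v) ∷ ps) x (r∉ ∷ u) = VecP.lookup∘update r (put ps x) v ∷
    All.zipWith (λ (r≢ , e) → trans (VecP.lookup∘update′ (λ e → r≢ (sym e)) (put ps x) v) e)
      (AllP.map⁻ r∉ , put-agrees ps x u)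

  put-id : ∀ ps (x : Vec Carrier n) → Agrees x ps → put ps x ≡ x
  put-id []             x []       = refl
  put-id ((r , v) ∷ ps) x (e ∷ es) rewrite put-id ps x es | sym e = VecP.[]≔-lookup x r

  agrees-ext : ∀ {ps} {x y : Vec Carrier n} → Agrees x ps → Agrees y ps →
    (∀ {l} → l ∉ dom ps → lookup x l ≡ lookup y l) → x ≡ y
  agrees-ext {ps = ps} {x} {y} ax ay e = lookup-ext pointwise
    where
    on-dom : ∀ {ps l} → Agrees x ps → Agrees y ps → l ∈ dom ps → lookup x l ≡ lookup y l
    on-dom {_ ∷ _} (p ∷ _) (q ∷ _) (here refl) = trans p (sym q)
    on-dom {_ ∷ _} (_ ∷ ax) (_ ∷ ay) (there m) = on-dom ax ay m
    pointwise : ∀ l → lookup x l ≡ lookup y l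
    pointwise l with l ∈? dom ps
    ... | yes m = on-dom ax ay m
    ... | no m  = e m

  ∑-≡ : ∀ (r : Fin n) c → ∑ (allFin n) (λ i → ⟦ i FinP.≟ r ⟧ * c) ≡ c
  ∑-≡ {n} r c = trans (∑-*ʳ (allFin n) c _) (trans (cong (_* c)
    (∑-unique≡1 (FinP._≟ r) (Uniq.allFin⁺ n) (λ e e′ → trans e (sym e′)) (∈-allFin r) refl)) (*-identityˡ c))

  ∑-∈≤length : ∀ (W : List (Fin n)) → ∑ (allFin n) (λ r → ⟦ r ∈? W ⟧) ≤ length W
  ∑-∈≤length {n} []      = ≤-reflexive (∑-zero (allFin n) (λ r → ⟦⟧-false (r ∈? []) λ ()))
  ∑-∈≤length {n} (w ∷ W) = begin
    ∑ (allFin n) (λ r → ⟦ r ∈? (w ∷ W) ⟧)                    ≤⟨ ∑-mono (allFin n) pointwise ⟩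
    ∑ (allFin n) (λ r → ⟦ r FinP.≟ w ⟧ * 1 + ⟦ r ∈? W ⟧)     ≡⟨ ∑-+ (allFin n) _ _ ⟩
    ∑ (allFin n) (λ r → ⟦ r FinP.≟ w ⟧ * 1) + ∑ (allFin n) (λ r → ⟦ r ∈? W ⟧)
                                                             ≤⟨ +-mono-≤ (≤-reflexive (∑-≡ w 1)) (∑-∈≤length W) ⟩
    suc (length W)                                           ∎
    where
    open ≤-Reasoning
    pointwise : ∀ r → ⟦ r ∈? (w ∷ W) ⟧ ≤ ⟦ r FinP.≟ w ⟧ * 1 + ⟦ r ∈? W ⟧
    pointwise r = by (r FinP.≟ w)
      where
      by : (e : Dec (r ≡ w)) → ⟦ r ∈? (w ∷ W) ⟧ ≤ ⟦ e ⟧ * 1 + ⟦ r ∈? W ⟧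
      by (yes _)  = ≤-trans (⟦⟧≤1 (r ∈? (w ∷ W))) (m≤m+n 1 _)
      by (no r≢w) = ⟦⟧-mono (r ∈? (w ∷ W)) (r ∈? W) (λ { (here e) → ⊥-elim (r≢w e) ; (there m) → m })

  -- The coordinates in L are frozen; Bal below gives them the dummy value 0#.
  free? : (L : List (Fin n)) (x : Vec Carrier n) (t : Carrier) (r : Fin n) → Dec (r ∉ L × lookup x r ≡ t)
  free? L x t r = ¬? (r ∈? L) ×-dec (lookup x r ≟ t)

  cnt : List (Fin n) → Vec Carrier n → Carrier → ℕ
  cnt {n} L x t = ∑ (allFin n) (λ r → ⟦ free? L x t r ⟧)

  cnt-cong : ∀ L (x x′ : Vec Carrier n) t → (∀ {r} → r ∉ L → lookup x r ≡ lookup x′ r) → cnt L x t ≡ cnt L x′ t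
  cnt-cong {n} L x x′ t e = ∑-cong (allFin n) (λ r → ⟦⟧-cong (free? L x t r) (free? L x′ t r)
    (λ (r∉ , p) → r∉ , trans (sym (e r∉)) p) (λ (r∉ , p) → r∉ , trans (e r∉) p))

  cnt-∷ : ∀ {L} (x : Vec Carrier n) t {r} → r ∉ L → cnt L x t ≡ cnt (r ∷ L) x t + ⟦ lookup x r ≟ t ⟧
  cnt-∷ {n} {L} x t {r} r∉ = begin
    cnt L x t                                                                      ≡⟨ ∑-cong (allFin n) pointwise ⟩
    ∑ (allFin n) (λ i → ⟦ free? (r ∷ L) x t i ⟧ + ⟦ i FinP.≟ r ⟧ * ⟦ lookup x r ≟ t ⟧)   ≡⟨ ∑-+ (allFin n) _ _ ⟩
    cnt (r ∷ L) x t + ∑ (allFin n) (λ i → ⟦ i FinP.≟ r ⟧ * ⟦ lookup x r ≟ t ⟧)           ≡⟨ cong (cnt (r ∷ L) x t +_) (∑-≡ r _) ⟩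
    cnt (r ∷ L) x t + ⟦ lookup x r ≟ t ⟧                                           ∎
    where
    open ≡-Reasoning
    pointwise : ∀ i → ⟦ free? L x t i ⟧ ≡ ⟦ free? (r ∷ L) x t i ⟧ + ⟦ i FinP.≟ r ⟧ * ⟦ lookup x r ≟ t ⟧
    pointwise i = by (i FinP.≟ r)
      where
      by : (e : Dec (i ≡ r)) → ⟦ free? L x t i ⟧ ≡ ⟦ free? (r ∷ L) x t i ⟧ + ⟦ e ⟧ * ⟦ lookup x r ≟ t ⟧
      by (yes refl) = trans (⟦⟧-cong (free? L x t r) (lookup x r ≟ t) proj₂ (λ e → r∉ , e))
            (sym (trans (cong (_+ _) (⟦⟧-false (free? (r ∷ L) x t r) (λ (r∉ , _) → r∉ (here refl)))) (+-identityʳ _)))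
      by (no i≢r) = trans (⟦⟧-cong (free? L x t i) (free? (r ∷ L) x t i)
              (λ (i∉ , e) → (λ { (here p) → i≢r p ; (there p) → i∉ p }) , e) (λ (i∉ , e) → i∉ ∘ there , e))
            (sym (+-identityʳ _))

  mult : Assignment n → Carrier → ℕ
  mult ps t = ∑ ps (λ (_ , v) → ⟦ v ≟ t ⟧)

  cnt-agrees : ∀ ps {L} (x : Vec Carrier n) t → Unique (dom ps) → All (_∉ L) (dom ps) → Agrees x ps →
    cnt L x t ≡ cnt (dom ps ++ L) x t + mult ps t
  cnt-agrees []             x t u        d        a        = sym (+-identityʳ _)
  cnt-agrees ((r , v) ∷ ps) {L} x t (r∉ ∷ u) (r∉L ∷ d) (refl ∷ a) = begin
    cnt L x t                                                                ≡⟨ cnt-agrees ps x t u d a ⟩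
    cnt (dom ps ++ L) x t + mult ps t                                        ≡⟨ cong (_+ mult ps t) (cnt-∷ x t fresh) ⟩
    cnt (r ∷ dom ps ++ L) x t + ⟦ lookup x r ≟ t ⟧ + mult ps t               ≡⟨ +-assoc (cnt (r ∷ dom ps ++ L) x t) _ _ ⟩
    cnt (r ∷ dom ps ++ L) x t + (⟦ lookup x r ≟ t ⟧ + mult ps t)             ∎
    where
    open ≡-Reasoning
    fresh : r ∉ dom ps ++ L
    fresh m = [ AllP.All¬⇒¬Any r∉ , r∉L ]′ (∈-++⁻ (dom ps) m)

  -- The dummy value gives each point of a smaller slice exactly one representative among the
  -- vectors of the original length, so counts over `vecs n` are correct.
  record Bal (L : List (Fin n)) (m : ℕ) (x : Vec Carrier n) : Set where
    constructor bal
    field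
      frozen   : All (λ r → lookup x r ≡ 0#) L
      balanced : All (λ t → cnt L x t ≡ m) elems

  Bal? : (L : List (Fin n)) (m : ℕ) (x : Vec Carrier n) → Dec (Bal L m x)
  Bal? L m x = map′ (λ (z , b) → bal z b) (λ (bal z b) → z , b) (All.all? (λ r → lookup x r ≟ 0#) L ×-dec All.all? (λ t → cnt L x t ℕ.≟ m) elems)

  Bal-cnt : ∀ {L m} {x : Vec Carrier n} → Bal L m x → ∀ t → cnt L x t ≡ m
  Bal-cnt (bal _ b) t = All.lookup b (complete t)

  ∉⇒≢ : ∀ {L : List (Fin n)} {l r} → r ∈ L → l ∉ L → l ≢ r
  ∉⇒≢ r∈ l∉ refl = l∉ r∈

  Bal-put : ∀ {L m} {x : Vec Carrier n} ps ps′ → dom ps ≡ dom ps′ → Unique (dom ps) → All (_∉ L) (dom ps) → Agrees x ps →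
    (∀ t → mult ps t ≡ mult ps′ t) → Bal L m x → Bal L m (put ps′ x)
  Bal-put {L = L} {m} {x} ps ps′ de u d a e b@(bal z _) = bal
    (All.tabulate (λ {r} r∈ → trans (lookup-put-∉ ps′ x (λ r∈′ → All.lookup d (subst (r ∈_) (sym de) r∈′) r∈)) (All.lookup z r∈)))
    (All.tabulate (λ {t} _ → begin
      cnt L (put ps′ x) t                                   ≡⟨ cnt-agrees ps′ (put ps′ x) t (subst Unique de u) (subst (All (_∉ L)) de d) (put-agrees ps′ x (subst Unique de u)) ⟩
      cnt (dom ps′ ++ L) (put ps′ x) t + mult ps′ t         ≡⟨ cong₂ _+_ (cnt-cong (dom ps′ ++ L) (put ps′ x) x t (λ r∉ → lookup-put-∉ ps′ x (r∉ ∘ ∈-++⁺ˡ))) (sym (e t)) ⟩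
      cnt (dom ps′ ++ L) x t + mult ps t                    ≡⟨ cong (λ z → cnt (z ++ L) x t + mult ps t) (sym de) ⟩
      cnt (dom ps ++ L) x t + mult ps t                     ≡⟨ sym (cnt-agrees ps x t u d a) ⟩
      cnt L x t                                             ≡⟨ Bal-cnt b t ⟩
      m                                                     ∎))
    where open ≡-Reasoning

  -- Swaps inside a slice and prescribed values.

  two : Fin n → Carrier → Fin n → Carrier → Assignment n
  two r v j w = (r , v) ∷ (j , w) ∷ []

  two-unique : ∀ {r j : Fin n} {v w} → r ≢ j → Unique (dom (two r v j w))
  two-unique r≢j = (r≢j ∷ []) ∷ [] ∷ []

  lookup-two : ∀ (r : Fin n) v j w x {l} → l ≢ r → l ≢ j → lookup (put (two r v j w) x) l ≡ lookup x l
  lookup-two r v j w x l≢r l≢j = lookup-put-∉ (two r v j w) x λ { (here e) → l≢r e ; (there (here e)) → l≢j e }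

  Bal-two : ∀ {L m} {x : Vec Carrier n} {r j v w} → r ≢ j → r ∉ L → j ∉ L → lookup x r ≡ v → lookup x j ≡ w →
    Bal L m x → Bal L m (put (two r w j v) x)
  Bal-two {r = r} {j} {v} {w} r≢j r∉ j∉ xr xj = Bal-put (two r v j w) (two r w j v) refl (two-unique {v = v} {w} r≢j)
    (r∉ ∷ j∉ ∷ []) (xr ∷ xj ∷ [])
    (λ t → trans (sym (+-assoc ⟦ v ≟ t ⟧ _ 0)) (trans (cong (_+ 0) (+-comm ⟦ v ≟ t ⟧ _)) (+-assoc ⟦ w ≟ t ⟧ _ 0)))

  two-differs : ∀ (r j : Fin n) v w l →
    (∃[ c ] ∃[ c′ ] (∀ x → lookup (put (two r w j v) x) l ≡ c × lookup (put (two r v j w) x) l ≡ c′))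
    ⊎ (∀ x → lookup (put (two r w j v) x) l ≡ lookup x l × lookup (put (two r v j w) x) l ≡ lookup x l)
  two-differs r j v w l with l FinP.≟ r
  ... | yes refl = inj₁ (w , v , λ x → VecP.lookup∘update r (x [ j ]≔ v) w , VecP.lookup∘update r (x [ j ]≔ w) v)
  ... | no l≢r with l FinP.≟ j
  ...   | yes refl = inj₁ (v , w , λ x →
            trans (VecP.lookup∘update′ l≢r (x [ j ]≔ v) w) (VecP.lookup∘update j x v) ,
            trans (VecP.lookup∘update′ l≢r (x [ j ]≔ w) v) (VecP.lookup∘update j x w))
  ...   | no l≢j = inj₂ (λ x → lookup-two r w j v x l≢r l≢j , lookup-two r v j w x l≢r l≢j)

  -- The last component rules out `a` itself when no coordinate in `rs` holds `t` at `a`: some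
  -- coordinate has really received the value.
  Swapped : List (Fin n) → ℕ → Vec Carrier n → Carrier → List (Fin n) → List (Fin n) → Fun n → Set
  Swapped L m a t rs js g = ∃[ a′ ] (Bal L m a′ × g a′ ≢ 0# ×
    (∀ l → l ∉ rs → l ∉ js → lookup a′ l ≡ lookup a l) × Any (λ r → lookup a′ r ≡ t) rs)

  -- Each swap is a difference of two substitutions of constants, which lowers the degree, so the
  -- alternating sum over the cube of all swaps vanishes.
  swap-some : ∀ {L m} {a : Vec Carrier n} {t} rs js {g : Fun n} → Deg (length rs) g → length rs ≡ length js →
    Unique rs → Unique js → All (λ r → r ∉ L × lookup a r ≢ t) rs → All (λ j → j ∉ L × lookup a j ≡ t) js →
    Bal L m a → g a ≢ 0# → Swapped L m a t rs js g
  swap-some [] js dg _ _ _ _ _ _ ga≢0 = ⊥-elim (ga≢0 (Deg0⇒≡0 dg _))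
  swap-some {n = n} {L} {m} {a} {t} (r ∷ rs) (j ∷ js) {g} dg len (r∉rs ∷ urs) (j∉js ∷ ujs) ((r∉L , ar≢t) ∷ ars) ((j∉L , aj≡t) ∷ ajs) ba ga≢0
    with Deg-difference (put (two r t j (lookup a r))) (put (two r (lookup a r) j t)) (two-differs r j (lookup a r) t) dg
  ... | h , dh , eh with g (put (two r t j (lookup a r)) a) ≟ 0#
  ...   | no ≢0 = put (two r t j (lookup a r)) a , Bal-two r≢j r∉L j∉L refl aj≡t ba , ≢0 ,
            (λ l l∉r l∉j → lookup-two r t j _ a (∉⇒≢ (here refl) l∉r) (∉⇒≢ (here refl) l∉j)) ,
            here (VecP.lookup∘update r (a [ j ]≔ lookup a r) t)
    where
    r≢j : r ≢ j
    r≢j refl = ar≢t aj≡t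
  -- As `g` vanishes after the swap but not before, `h` is nonzero at `a`. A point `a′` obtained for
  -- `h` has `g (φ a′)` or `g (ψ a′) = g a′` nonzero, which gives the point for `g`.
  ...   | yes ≡0 = finish (swap-some rs js dh (suc-injective len) urs ujs ars ajs ba ha≢0)
    where
    r≢j : r ≢ j
    r≢j refl = ar≢t aj≡t
    v = lookup a r
    φ ψ : Vec Carrier n → Vec Carrier n
    φ = put (two r t j v)
    ψ = put (two r v j t)
    ha≢0 : h a ≢ 0#
    ha≢0 ha≡0 = ga≢0 (trans (cong g (sym (put-id (two r v j t) a (refl ∷ aj≡t ∷ []))))
      (trans (sym (⊕-identityʳ _)) (trans (cong (g (ψ a) ⊕_) (sym ha≡0)) (trans (sym (eh a)) ≡0))))
    r∉js : r ∉ js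
    r∉js m = ar≢t (proj₂ (All.lookup ajs m))
    j∉rs : j ∉ rs
    j∉rs m = proj₂ (All.lookup ars m) aj≡t
    finish : Swapped L m a t rs js h → Swapped L m a t (r ∷ rs) (j ∷ js) g
    finish (a′ , ba′ , ha′≢0 , same , any) with g (φ a′) ≟ 0#
    ... | no ≢0 = φ a′ , Bal-two r≢j r∉L j∉L a′r a′j ba′ , ≢0 ,
            (λ l l∉r l∉j → trans (lookup-two r t j _ a′ (∉⇒≢ (here refl) l∉r) (∉⇒≢ (here refl) l∉j)) (same l (l∉r ∘ there) (l∉j ∘ there))) ,
            here (VecP.lookup∘update r (a′ [ j ]≔ v) t)
      where
      a′r = same r (AllP.All¬⇒¬Any r∉rs) r∉js
      a′j = trans (same j j∉rs (AllP.All¬⇒¬Any j∉js)) aj≡t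
    ... | yes ≡0′ = a′ , ba′ , (λ ga′≡0 → ha′≢0 (⊕-cancelˡ (g (ψ a′)) (trans (sym (eh a′)) (trans ≡0′
              (trans (sym (trans (cong g ψa′) ga′≡0)) (sym (⊕-identityʳ _))))))) ,
            (λ l l∉r l∉j → same l (l∉r ∘ there) (l∉j ∘ there)) , there any
      where
      ψa′ : ψ a′ ≡ a′
      ψa′ = put-id (two r v j t) a′
        (same r (AllP.All¬⇒¬Any r∉rs) r∉js ∷ trans (same j j∉rs (AllP.All¬⇒¬Any j∉js)) aj≡t ∷ [])

  allVecs-complete : ∀ n (x : Vec Carrier n) → x ∈ allVecs F elems n
  allVecs-complete zero    []      = here refl
  allVecs-complete (suc n) (v ∷ x) = ∈-concatMap⁺ _ (lose (complete v) (∈-map⁺ (v ∷_) (allVecs-complete n x)))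

  allVecs-unique : ∀ n → Unique (allVecs F elems n)
  allVecs-unique zero    = [] ∷ []
  allVecs-unique (suc n) = go unique
    where
    go : ∀ {vs} → Unique vs → Unique (List.concatMap (λ v → map (v ∷_) (allVecs F elems n)) vs)
    go []                = []
    go {v ∷ vs} (v∉ ∷ u) = Uniq.++⁺ (Uniq.map⁺ (λ { refl → refl }) (allVecs-unique n)) (go u) disjoint
      where
      head-∈ : ∀ vs {x} → x ∈ List.concatMap (λ v → map (v ∷_) (allVecs F elems n)) vs → Vec.head x ∈ vs
      head-∈ (w ∷ ws) m with ∈-++⁻ (map (w ∷_) (allVecs F elems n)) m
      ... | inj₂ m′ = there (head-∈ ws m′)
      ... | inj₁ m′ with ∈-map⁻ (w ∷_) m′
      ...   | _ , _ , refl = here refl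
      disjoint : ∀ {x} → ¬ (x ∈ map (v ∷_) (allVecs F elems n) × x ∈ List.concatMap (λ v → map (v ∷_) (allVecs F elems n)) vs)
      disjoint (m , m′) with ∈-map⁻ (v ∷_) m
      ... | _ , _ , refl = AllP.All¬⇒¬Any v∉ (head-∈ vs m′)

  Alive : List (Fin n) → ℕ → Fun n → Assignment n → Set
  Alive L m g cs = ∃[ a ] (Bal L m a × g a ≢ 0# × Agrees a cs)

  ∃Vec? : ∀ {P : Vec Carrier n → Set} → (∀ x → Dec (P x)) → Dec (∃ P)
  ∃Vec? {n} P? = map′ Any.satisfied (λ (x , p) → lose (allVecs-complete n x) p) (Any.any? P? (allVecs F elems n))

  Alive? : ∀ L m (g : Fun n) cs → Dec (Alive L m g cs)
  Alive? L m g cs = ∃Vec? (λ a → Bal? L m a ×-dec (¬? (g a ≟ 0#) ×-dec All.all? (λ (r , v) → lookup a r ≟ v) cs))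

  -- `W` collects the coordinates that cannot take the value `t`. Were there `d + 1` of them, they
  -- could be paired with `d + 1` coordinates already holding `t`, and `swap-some` would give `t` to
  -- one of them. The size hypothesis provides the partners outside `cs`; no constrained coordinate
  -- moves, so `cs` survives.
  Alive-extend : ∀ {L m d} {g : Fun n} {cs} t → Deg (suc d) g → Alive L m g cs → suc d + length cs ≤ m →
    ∃[ W ] (length W ≤ d × (∀ {r} → r ∉ L → r ∉ dom cs → r ∉ W → Alive L m g ((r , t) ∷ cs)))
  Alive-extend {n} {L} {m} {d} {g} {cs} t dg (a , ba , ga≢0 , agr) big = W , W-short , W-covers
    where
    Bad : Fin n → Set
    Bad r = (r ∉ L × r ∉ dom cs) × ¬ Alive L m g ((r , t) ∷ cs)
    bad? : ∀ r → Dec (Bad r)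
    bad? r = (¬? (r ∈? L) ×-dec ¬? (r ∈? dom cs)) ×-dec ¬? (Alive? L m g ((r , t) ∷ cs))
    W = filter bad? (allFin n)
    W-covers : ∀ {r} → r ∉ L → r ∉ dom cs → r ∉ W → Alive L m g ((r , t) ∷ cs)
    W-covers {r} r∉L r∉cs r∉W = decidable-stable (Alive? L m g ((r , t) ∷ cs))
      (λ dead → r∉W (∈-filter⁺ bad? (∈-allFin r) ((r∉L , r∉cs) , dead)))
    Partner : Fin n → Set
    Partner j = (j ∉ L × lookup a j ≡ t) × j ∉ dom cs
    partner? : ∀ j → Dec (Partner j)
    partner? j = free? L a t j ×-dec ¬? (j ∈? dom cs)
    partners = filter partner? (allFin n)
    partners-long : suc d ≤ length partners
    partners-long = +-cancelʳ-≤ (length cs) (suc d) (length partners) (begin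
      suc d + length cs                                                         ≤⟨ big ⟩
      m                                                                         ≡⟨ sym (Bal-cnt ba t) ⟩
      cnt L a t                                                                 ≤⟨ ∑-mono (allFin n) pointwise ⟩
      ∑ (allFin n) (λ j → ⟦ partner? j ⟧ + ⟦ j ∈? dom cs ⟧)                     ≡⟨ ∑-+ (allFin n) _ _ ⟩
      ∑ (allFin n) (λ j → ⟦ partner? j ⟧) + ∑ (allFin n) (λ j → ⟦ j ∈? dom cs ⟧)
        ≤⟨ +-mono-≤ (≤-reflexive (sym (length-filter-∑ partner? (allFin n)))) (∑-∈≤length (dom cs)) ⟩
      length partners + length (dom cs)                                                ≡⟨ cong (length partners +_) (ListP.length-map proj₁ cs) ⟩
      length partners + length cs                                                      ∎)
      where
      open ≤-Reasoning
      pointwise : ∀ j → ⟦ free? L a t j ⟧ ≤ ⟦ partner? j ⟧ + ⟦ j ∈? dom cs ⟧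
      pointwise j = by (j ∈? dom cs)
        where
        by : (e : Dec (j ∈ dom cs)) → ⟦ free? L a t j ⟧ ≤ ⟦ free? L a t j ×-dec ¬? e ⟧ + ⟦ e ⟧
        by (yes j∈) = ≤-trans (⟦⟧≤1 (free? L a t j)) (m≤n+m 1 _)
        by (no j∉)  = ≤-trans (⟦⟧-mono (free? L a t j) (free? L a t j ×-dec ¬? (no j∉)) (λ p → p , j∉)) (m≤m+n _ 0)
    take-length : ∀ (xs : List (Fin n)) → suc d ≤ length xs → length (take (suc d) xs) ≡ suc d
    take-length xs le = trans (ListP.length-take (suc d) xs) (m≤n⇒m⊓n≡m le)
    W-short : length W ≤ d
    W-short = ≮⇒≥ λ long → contradict
      (swap-some (take (suc d) W) (take (suc d) partners) (subst (λ D → Deg D g) (sym (take-length W long)) dg)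
        (trans (take-length W long) (sym (take-length partners partners-long)))
        (Uniq.take⁺ (suc d) (Uniq.filter⁺ bad? (Uniq.allFin⁺ n))) (Uniq.take⁺ (suc d) (Uniq.filter⁺ partner? (Uniq.allFin⁺ n)))
        (All.map (λ (((r∉L , _) , dead)) → r∉L , λ ar≡t → dead (a , ba , ga≢0 , ar≡t ∷ agr)) Ws)
        (All.map proj₁ Js) ba ga≢0)
      where
      Ws : All Bad (take (suc d) W)
      Ws = AllP.take⁺ (suc d) (AllP.all-filter bad? (allFin n))
      Js : All Partner (take (suc d) partners)
      Js = AllP.take⁺ (suc d) (AllP.all-filter partner? (allFin n))
      contradict : ¬ Swapped L m a t (take (suc d) W) (take (suc d) partners) g
      contradict (a′ , ba′ , ga′≢0 , same , any) with All.lookupAny Ws any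
      ... | ((_ , _) , dead) , a′r≡t = dead (a′ , ba′ , ga′≢0 , a′r≡t ∷ All.tabulate
            (λ {p} p∈ → trans (same _ (λ m → proj₂ (proj₁ (All.lookup Ws m)) (∈-map⁺ proj₁ p∈))
                                    (λ m → proj₂ (All.lookup Js m) (∈-map⁺ proj₁ p∈))) (All.lookup agr p∈)))

  -- Blocks of coordinates.

  vecs : ∀ n → List (Vec Carrier n)
  vecs n = allVecs F elems n

  _≟ᵛ_ : (x y : Vec Carrier n) → Dec (x ≡ y)
  _≟ᵛ_ = VecP.≡-dec _≟_

  line : Carrier → Assignment n → Assignment n
  line y = map (λ (r , σ) → r , y ⊕ σ)

  zeros : Assignment n → Assignment n
  zeros = map (λ (r , _) → r , 0#)

  dom-line : ∀ y (bs : Assignment n) → dom (line y bs) ≡ dom bs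
  dom-line y bs = sym (ListP.map-∘ bs)

  dom-zeros : ∀ (bs : Assignment n) → dom (zeros bs) ≡ dom bs
  dom-zeros bs = sym (ListP.map-∘ bs)

  lookup-line : ∀ (bs : Assignment n) l →
    (∃[ σ ] (∀ y x → lookup (put (line y bs) x) l ≡ y ⊕ σ)) ⊎ (∀ y x → lookup (put (line y bs) x) l ≡ lookup x l)
  lookup-line []             l = inj₂ (λ _ _ → refl)
  lookup-line ((r , σ) ∷ bs) l with l FinP.≟ r
  ... | yes refl = inj₁ (σ , λ y x → VecP.lookup∘update r (put (line y bs) x) (y ⊕ σ))
  ... | no l≢r with lookup-line bs l
  ...   | inj₁ (τ , e) = inj₁ (τ , λ y x → trans (VecP.lookup∘update′ l≢r (put (line y bs) x) (y ⊕ σ)) (e y x))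
  ...   | inj₂ e       = inj₂ (λ y x → trans (VecP.lookup∘update′ l≢r (put (line y bs) x) (y ⊕ σ)) (e y x))

  -- `full` says that for each `y` the values `y ⊕ σ` run through the field once, so a block
  -- accounts for exactly one copy of every value.
  record Block (L : List (Fin n)) (bs : Assignment n) : Set where
    field
      distinct : Unique (dom bs)
      fresh    : All (_∉ L) (dom bs)
      full     : ∀ y t → mult (line y bs) t ≡ 1

  module _ {L : List (Fin n)} {bs : Assignment n} (block : Block L bs) where
    open Block block

    line-agrees : ∀ y x → Agrees (put (line y bs) x) (line y bs)
    line-agrees y x = put-agrees (line y bs) x (subst Unique (sym (dom-line y bs)) distinct)

    zeros-agrees : ∀ x → Agrees (put (zeros bs) x) (zeros bs)
    zeros-agrees x = put-agrees (zeros bs) x (subst Unique (sym (dom-zeros bs)) distinct)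

    off-line : ∀ y x {l} → l ∉ dom bs → lookup (put (line y bs) x) l ≡ lookup x l
    off-line y x l∉ = lookup-put-∉ (line y bs) x (subst (_ ∉_) (sym (dom-line y bs)) l∉)

    off-zeros : ∀ x {l} → l ∉ dom bs → lookup (put (zeros bs) x) l ≡ lookup x l
    off-zeros x l∉ = lookup-put-∉ (zeros bs) x (subst (_ ∉_) (sym (dom-zeros bs)) l∉)

    cnt-line : ∀ {y} x t → Agrees x (line y bs) → cnt L x t ≡ suc (cnt (dom bs ++ L) x t)
    cnt-line {y} x t agr = begin
      cnt L x t                                                  ≡⟨ cnt-agrees (line y bs) x t (subst Unique (sym (dom-line y bs)) distinct)
                                                                      (subst (All (_∉ L)) (sym (dom-line y bs)) fresh) agr ⟩
      cnt (dom (line y bs) ++ L) x t + mult (line y bs) t        ≡⟨ cong₂ (λ D k → cnt (D ++ L) x t + k) (dom-line y bs) (full y t) ⟩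
      cnt (dom bs ++ L) x t + 1                                  ≡⟨ +-comm _ 1 ⟩
      suc (cnt (dom bs ++ L) x t)                                ∎
      where open ≡-Reasoning

    -- Together with `insert` this is the bijection between points of a slice lying on some line of
    -- the block and pairs of a value `y` and a point of the slice with one copy fewer.
    erase : ∀ {m y x} → Bal L (suc m) x → Agrees x (line y bs) → Bal (dom bs ++ L) m (put (zeros bs) x)
    erase {m} {y} {x} b@(bal z _) agr = bal (AllP.++⁺ on off) (All.tabulate (λ {t} _ →
        trans (cnt-cong (dom bs ++ L) (put (zeros bs) x) x t (λ r∉ → off-zeros x (r∉ ∘ ∈-++⁺ˡ)))
              (suc-injective (trans (sym (cnt-line x t agr)) (Bal-cnt b t)))))
      where
      on : All (λ r → lookup (put (zeros bs) x) r ≡ 0#) (dom bs)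
      on = AllP.map⁺ (AllP.map⁻ (zeros-agrees x))
      off : All (λ r → lookup (put (zeros bs) x) r ≡ 0#) L
      off = All.tabulate (λ {r} r∈ → trans (off-zeros x (λ r∈′ → All.lookup fresh r∈′ r∈)) (All.lookup z r∈))

    insert : ∀ {m x} y → Bal (dom bs ++ L) m x → Bal L (suc m) (put (line y bs) x)
    insert {m} {x} y b@(bal z _) = bal
      (All.tabulate (λ {r} r∈ → trans (off-line y x (λ r∈′ → All.lookup fresh r∈′ r∈)) (All.lookup (AllP.++⁻ʳ (dom bs) z) r∈)))
      (All.tabulate (λ {t} _ → trans (cnt-line (put (line y bs) x) t (line-agrees y x)) (cong suc
        (trans (cnt-cong (dom bs ++ L) (put (line y bs) x) x t (λ r∉ → off-line y x (r∉ ∘ ∈-++⁺ˡ))) (Bal-cnt b t)))))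

    insert-erase : ∀ {y x} → Agrees x (line y bs) → put (line y bs) (put (zeros bs) x) ≡ x
    insert-erase {y} {x} agr = agrees-ext (line-agrees y _) agr
      (λ l∉ → trans (lookup-put-∉ (line y bs) _ l∉) (off-zeros x (subst (_ ∉_) (dom-line y bs) l∉)))

    erase-insert : ∀ {m y x} → Bal (dom bs ++ L) m x → put (zeros bs) (put (line y bs) x) ≡ x
    erase-insert {m} {y} {x} (bal z _) = agrees-ext (zeros-agrees _) (AllP.map⁺ (AllP.map⁻ (AllP.++⁻ˡ (dom bs) z)))
      (λ l∉ → trans (lookup-put-∉ (zeros bs) _ l∉) (off-line y x (subst (_ ∉_) (dom-zeros bs) l∉)))

  -- Restriction to a block.

  Follows : Fin n → Assignment n → Vec Carrier n → Set
  Follows e ps x = All (λ (r , σ) → lookup x r ≡ lookup x e ⊕ σ) ps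

  Follows? : ∀ e (ps : Assignment n) x → Dec (Follows e ps x)
  Follows? e ps x = All.all? (λ (r , σ) → lookup x r ≟ (lookup x e ⊕ σ)) ps

  follows⇒agrees : ∀ {e} {ps : Assignment n} x → Follows e ps x → Agrees x (line (lookup x e) ((e , 0#) ∷ ps))
  follows⇒agrees x fl = sym (⊕-identityʳ _) ∷ AllP.map⁺ fl

  agrees⇒follows : ∀ {e y} {ps : Assignment n} x → Agrees x (line y ((e , 0#) ∷ ps)) → lookup x e ≡ y × Follows e ps x
  agrees⇒follows {y = y} x (h ∷ t) = h′ , All.map (λ p → trans p (cong (_⊕ _) (sym h′))) (AllP.map⁻ t)
    where h′ = trans h (⊕-identityʳ y)

  size : List (Fin n) → ℕ → ℕ
  size {n} L m = ∑ (vecs n) (λ x → ⟦ Bal? L m x ⟧)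

  nonzeros : List (Fin n) → ℕ → Fun n → ℕ
  nonzeros {n} L m f = ∑ (vecs n) (λ x → ⟦ Bal? L m x ×-dec ¬? (f x ≟ 0#) ⟧)

  sizeF : List (Fin n) → ℕ → Fin n → Assignment n → ℕ
  sizeF {n} L m e ps = ∑ (vecs n) (λ x → ⟦ Bal? L m x ×-dec Follows? e ps x ⟧)

  nonzerosF : List (Fin n) → ℕ → Fun n → Fin n → Assignment n → ℕ
  nonzerosF {n} L m f e ps = ∑ (vecs n) (λ x → ⟦ (Bal? L m x ×-dec ¬? (f x ≟ 0#)) ×-dec Follows? e ps x ⟧)

  Flat : List (Fin n) → ℕ → Fun n → Assignment n → Set
  Flat L m f bs = ∀ {x} → Bal (dom bs ++ L) m x → ∀ y y′ → f (put (line y bs) x) ≡ f (put (line y′ bs) x)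

  module _ {L : List (Fin n)} {e : Fin n} {ps : Assignment n} (block : Block L ((e , 0#) ∷ ps)) where

    private
      bs : Assignment n
      bs = (e , 0#) ∷ ps
      L′ : List (Fin n)
      L′ = dom bs ++ L

    sizeF≤ : ∀ m → sizeF L (suc m) e ps ≤ card * size L′ m
    sizeF≤ m = begin
      sizeF L (suc m) e ps
        ≤⟨ ∑-injection (λ x → Bal? L (suc m) x ×-dec Follows? e ps x) (λ (y , x) → Bal? L′ m x) (≡-dec× _≟_ _≟ᵛ_)
             (allVecs-unique n) (λ (y , x) → ∈-cartesianProduct⁺ (complete y) (allVecs-complete n x))
             (λ x → lookup x e , put (zeros bs) x)
             (λ {x} (b , fl) → erase block b (follows⇒agrees x fl)) injective ⟩
      ∑ (cartesianProduct elems (vecs n)) (λ (y , x) → ⟦ Bal? L′ m x ⟧)   ≡⟨ ∑-cartesian elems (vecs n) _ ⟩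
      ∑ elems (λ y → size L′ m)                                          ≡⟨ ∑-cong elems (λ _ → sym (*-identityˡ (size L′ m))) ⟩
      ∑ elems (λ y → 1 * size L′ m)                                      ≡⟨ ∑-*ʳ elems (size L′ m) (λ _ → 1) ⟩
      ∑ elems (λ y → 1) * size L′ m                                      ≡⟨ cong (_* size L′ m) (∑-one elems) ⟩
      card * size L′ m                                                   ∎
      where
      open ≤-Reasoning
      injective : ∀ {x x′} → Bal L (suc m) x × Follows e ps x → Bal L (suc m) x′ × Follows e ps x′ →
        (lookup x e , put (zeros bs) x) ≡ (lookup x′ e , put (zeros bs) x′) → x ≡ x′
      injective {x} {x′} (_ , fl) (_ , fl′) eq = trans (sym (insert-erase block (follows⇒agrees x fl)))
        (trans (cong₂ (λ y z → put (line y bs) z) (cong proj₁ eq) (cong proj₂ eq)) (insert-erase block (follows⇒agrees x′ fl′)))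

    nonzerosF≥ : ∀ m f → ∑ (vecs n) (λ x → ∑ elems (λ y → ⟦ Bal? L′ m x ×-dec ¬? (f (put (line y bs) x) ≟ 0#) ⟧))
      ≤ nonzerosF L (suc m) f e ps
    nonzerosF≥ m f = begin
      ∑ (vecs n) (λ x → ∑ elems (λ y → ⟦ Bal? L′ m x ×-dec ¬? (f (put (line y bs) x) ≟ 0#) ⟧))   ≡⟨ sym (∑-cartesian (vecs n) elems _) ⟩
      ∑ (cartesianProduct (vecs n) elems) (λ (x , y) → ⟦ Bal? L′ m x ×-dec ¬? (f (put (line y bs) x) ≟ 0#) ⟧)
        ≤⟨ ∑-injection (λ (x , y) → Bal? L′ m x ×-dec ¬? (f (put (line y bs) x) ≟ 0#))
             (λ x → (Bal? L (suc m) x ×-dec ¬? (f x ≟ 0#)) ×-dec Follows? e ps x) _≟ᵛ_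
             (Uniq.cartesianProduct⁺ (allVecs-unique n) unique) (allVecs-complete n) (λ (x , y) → put (line y bs) x)
             (λ {(x , y)} (b , nz) → (insert block y b , nz) , proj₂ (agrees⇒follows (put (line y bs) x) (line-agrees block y x))) injective ⟩
      nonzerosF L (suc m) f e ps ∎
      where
      open ≤-Reasoning
      injective : ∀ {p p′ : Vec Carrier n × Carrier} →
        Bal L′ m (proj₁ p) × f (put (line (proj₂ p) bs) (proj₁ p)) ≢ 0# →
        Bal L′ m (proj₁ p′) × f (put (line (proj₂ p′) bs) (proj₁ p′)) ≢ 0# →
        put (line (proj₂ p) bs) (proj₁ p) ≡ put (line (proj₂ p′) bs) (proj₁ p′) → p ≡ p′
      injective {x , y} {x′ , y′} (b , _) (b′ , _) eq = cong₂ _,_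
        (trans (sym (erase-insert block {y = y} b)) (trans (cong (put (zeros bs)) eq) (erase-insert block b′)))
        (trans (sym (proj₁ (agrees⇒follows {ps = ps} (put (line y bs) x) (line-agrees block y x))))
          (trans (cong (λ z → lookup z e) eq) (proj₁ (agrees⇒follows {ps = ps} (put (line y′ bs) x′) (line-agrees block y′ x′)))))

    -- The degree in `y` is meant for functions on the smaller slice: it is the largest index below
    -- `k` whose coefficient is nonzero somewhere on that slice.
    leading : ∀ m (c : ℕ → Fun n) k → (∀ i → i < k → ¬ Alive L′ m (c i) [])
      ⊎ ∃[ j ] (j < k × Alive L′ m (c j) [] × (∀ i → j < i → i < k → ¬ Alive L′ m (c i) []))
    leading m c zero    = inj₁ (λ i ())
    leading m c (suc k) with Alive? L′ m (c k) []
    ... | yes al = inj₂ (k , ≤-refl , al , λ i k<i i<1+k _ → <-irrefl refl (<-≤-trans k<i (s≤s⁻¹ i<1+k)))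
    ... | no ¬al with leading m c k
    ...   | inj₁ none = inj₁ (λ i i<1+k → below i (m<1+n⇒m<n∨m≡n i<1+k))
      where
      below : ∀ i → i < k ⊎ i ≡ k → ¬ Alive L′ m (c i) []
      below i (inj₁ i<k)  = none i i<k
      below .k (inj₂ refl) = ¬al
    ...   | inj₂ (j , j<k , al , none) = inj₂ (j , m<n⇒m<1+n j<k , al , λ i j<i i<1+k → above i j<i (m<1+n⇒m<n∨m≡n i<1+k))
      where
      above : ∀ i → j < i → i < k ⊎ i ≡ k → ¬ Alive L′ m (c i) []
      above i j<i (inj₁ i<k)  = none i j<i i<k
      above .k j<i (inj₂ refl) = ¬al

    dead⇒0 : ∀ {m} {g : Fun n} → ¬ Alive L′ m g [] → ∀ {x} → Bal L′ m x → g x ≡ 0#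
    dead⇒0 {g = g} dead {x} b = decidable-stable (g x ≟ 0#) (λ nz → dead (x , b , nz , []))

    -- All coefficients above the leading one vanish on the smaller slice, so wherever `c j` is
    -- nonzero the restriction has degree exactly `j` and at least `card ∸ j` nonzero values. The
    -- given nonzero point on the block prevents all coefficients from vanishing.
    block-restriction : ∀ {D f} m → Deg D f → (∃[ a ] (Bal L (suc m) a × f a ≢ 0# × Follows e ps a)) →
      ∃[ j ] ∃[ g ] (j < card × Deg (D ∸ j) g × Alive L′ m g [] ×
        (card ∸ j) * nonzeros L′ m g ≤ nonzerosF L (suc m) f e ps × (j ≡ 0 → Flat L m f bs))
    block-restriction {D} {f} m df (a , ba , fa≢0 , fl)
      with newton-expansion (λ y → put (line y bs)) (lookup-line bs) df
    ... | c , dc , ec with leading m c card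
    ...   | inj₁ none = ⊥-elim (fa≢0 (begin
            f a                                                        ≡⟨ cong f (sym (insert-erase block (follows⇒agrees a fl))) ⟩
            f (put (line (lookup a e) bs) (put (zeros bs) a))          ≡⟨ ec _ _ ⟩
            newton elems (λ i → c i (put (zeros bs) a)) (lookup a e)
              ≡⟨ newton-zero elems _ _ (λ i i< → dead⇒0 (none i i<) (erase block ba (follows⇒agrees a fl))) ⟩
            0#                                                         ∎))
      where open ≡-Reasoning
    ...   | inj₂ (j , j<q , al , none) = j , c j , j<q , dc j , al , bound , flat
      where
      degree : ∀ {x} → Bal L′ m x → HasDegree (c j x) j (newton elems (λ i → c i x))
      degree {x} b = newton-degree elems (λ i → c i x) j j<q (λ i j<i i<q → dead⇒0 (none i j<i i<q) b)
      pointwise : ∀ x → (card ∸ j) * ⟦ Bal? L′ m x ×-dec ¬? (c j x ≟ 0#) ⟧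
        ≤ ∑ elems (λ y → ⟦ Bal? L′ m x ×-dec ¬? (f (put (line y bs) x) ≟ 0#) ⟧)
      pointwise x = by (Bal? L′ m x ×-dec ¬? (c j x ≟ 0#))
        where
        open ≤-Reasoning
        by : (h : Dec (Bal L′ m x × c j x ≢ 0#)) → (card ∸ j) * ⟦ h ⟧
          ≤ ∑ elems (λ y → ⟦ Bal? L′ m x ×-dec ¬? (f (put (line y bs) x) ≟ 0#) ⟧)
        by (no _)        = ≤-trans (≤-reflexive (*-zeroʳ (card ∸ j))) z≤n
        by (yes (b , l)) = begin
          (card ∸ j) * 1                                                       ≡⟨ *-identityʳ _ ⟩
          card ∸ j                                                             ≤⟨ nonroots l (degree b) ⟩
          ∑ elems (λ y → ⟦ ¬? (newton elems (λ i → c i x) y ≟ 0#) ⟧)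
            ≤⟨ ∑-mono elems (λ y → ⟦⟧-mono (¬? (newton elems (λ i → c i x) y ≟ 0#))
                 (Bal? L′ m x ×-dec ¬? (f (put (line y bs) x) ≟ 0#)) (λ nz → b , λ z → nz (trans (sym (ec y x)) z))) ⟩
          ∑ elems (λ y → ⟦ Bal? L′ m x ×-dec ¬? (f (put (line y bs) x) ≟ 0#) ⟧) ∎
      bound : (card ∸ j) * nonzeros L′ m (c j) ≤ nonzerosF L (suc m) f e ps
      bound = begin
        (card ∸ j) * nonzeros L′ m (c j)                                       ≡⟨ sym (∑-*ˡ (vecs n) (card ∸ j) _) ⟩
        ∑ (vecs n) (λ x → (card ∸ j) * ⟦ Bal? L′ m x ×-dec ¬? (c j x ≟ 0#) ⟧)  ≤⟨ ∑-mono (vecs n) pointwise ⟩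
        ∑ (vecs n) (λ x → ∑ elems (λ y → ⟦ Bal? L′ m x ×-dec ¬? (f (put (line y bs) x) ≟ 0#) ⟧)) ≤⟨ nonzerosF≥ m f ⟩
        nonzerosF L (suc m) f e ps                                             ∎
        where open ≤-Reasoning
      flat : j ≡ 0 → Flat L m f bs
      flat refl {x} b y y′ = trans (value y) (sym (value y′))
        where
        constant-term : ∀ {l g} → HasDegree l 0 g → ∀ y → g y ≡ l
        constant-term (constant e) = e
        value : ∀ y → f (put (line y bs) x) ≡ c 0 x
        value y = trans (ec y x) (constant-term (degree b) y)

  -- Transpositions and functions that are not symmetric.

  ∑-strict : ∀ {A : Set} {xs : List A} {f g : A → ℕ} {x} → (∀ x → f x ≤ g x) → x ∈ xs → f x < g x → ∑ xs f < ∑ xs g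
  ∑-strict {xs = _ ∷ xs} le (here refl) lt = +-mono-<-≤ lt (∑-mono xs le)
  ∑-strict               le (there x∈)  lt = +-mono-≤-< (le _) (∑-strict le x∈ lt)

  swap : Fin n → Fin n → Vec Carrier n → Vec Carrier n
  swap u u′ x = put (two u (lookup x u′) u′ (lookup x u)) x

  Bal-swap : ∀ {L m} {x : Vec Carrier n} {u u′} → u ≢ u′ → u ∉ L → u′ ∉ L → Bal L m x → Bal L m (swap u u′ x)
  Bal-swap u≢ u∉ u′∉ = Bal-two u≢ u∉ u′∉ refl refl

  lookup-swapˡ : ∀ (u u′ : Fin n) x → lookup (swap u u′ x) u ≡ lookup x u′
  lookup-swapˡ u u′ x = VecP.lookup∘update u (x [ u′ ]≔ lookup x u) (lookup x u′)

  lookup-swapʳ : ∀ {u u′ : Fin n} x → u ≢ u′ → lookup (swap u u′ x) u′ ≡ lookup x u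
  lookup-swapʳ {u = u} {u′} x u≢ = trans (VecP.lookup∘update′ (u≢ ∘ sym) (x [ u′ ]≔ lookup x u) (lookup x u′))
    (VecP.lookup∘update u′ x (lookup x u))

  lookup-swap-other : ∀ {u u′ : Fin n} x {l} → l ≢ u → l ≢ u′ → lookup (swap u u′ x) l ≡ lookup x l
  lookup-swap-other {u = u} {u′} x = lookup-two u (lookup x u′) u′ (lookup x u) x

  swap-involutive : ∀ {u u′ : Fin n} x → u ≢ u′ → swap u u′ (swap u u′ x) ≡ x
  swap-involutive {u = u} {u′} x u≢ = agrees-ext {ps = two u (lookup x u) u′ (lookup x u′)}
    (trans (lookup-swapˡ u u′ (swap u u′ x)) (lookup-swapʳ x u≢) ∷ trans (lookup-swapʳ (swap u u′ x) u≢) (lookup-swapˡ u u′ x) ∷ [])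
    (refl ∷ refl ∷ [])
    (λ l∉ → trans (lookup-swap-other (swap u u′ x) (λ e → l∉ (here e)) (λ e → l∉ (there (here e))))
                  (lookup-swap-other x (λ e → l∉ (here e)) (λ e → l∉ (there (here e)))))

  Asymmetry : List (Fin n) → ℕ → Fun n → Set
  Asymmetry {n} L m f = ∃[ u ] ∃[ u′ ] ∃[ w ] (u ≢ u′ × u ∉ L × u′ ∉ L × Bal L m w × f w ≢ f (swap u u′ w))

  -- Transpositions connect the slice: each swap in the walk from `x` to `a` corrects a coordinate
  -- without spoiling another. As `f` differs at the two ends, some swap on the way changes it.
  asymmetry : ∀ {L m} {f : Fun n} {a x} → Bal L m a → Bal L m x → f a ≢ f x → Asymmetry L m f
  asymmetry {n} {L} {m} {f} {a} {x} ba bx = go (suc (mismatch x)) bx ≤-refl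
    where
    differs? : ∀ x r → Dec (lookup x r ≢ lookup a r)
    differs? x r = ¬? (lookup x r ≟ lookup a r)
    mismatch : Vec Carrier n → ℕ
    mismatch x = ∑ (allFin n) (λ r → ⟦ differs? x r ⟧)
    go : ∀ k {x} → Bal L m x → mismatch x < k → f a ≢ f x → Asymmetry L m f
    go (suc k) {x} bx (s≤s mk) fa≢fx with FinP.any? (differs? x)
    ... | no same = ⊥-elim (fa≢fx (cong f (lookup-ext
            (λ i → sym (decidable-stable (lookup x i ≟ lookup a i) (λ ne → same (i , ne)))))))
    ... | yes (r , xr≢) = swapping (FinP.any? (λ j → free? L x (lookup a r) j ×-dec ¬? (lookup a j ≟ lookup a r)))
      where
      t = lookup a r
      r∉L : r ∉ L
      r∉L r∈ = xr≢ (trans (All.lookup (Bal.frozen bx) r∈) (sym (All.lookup (Bal.frozen ba) r∈)))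
      swapping : Dec (∃[ j ] ((j ∉ L × lookup x j ≡ t) × lookup a j ≢ t)) → Asymmetry L m f
      -- Otherwise every free coordinate with value `t` at `x` also has it at `a`, where `r` is an
      -- additional one; but both counts equal `m`.
      swapping (no none) = ⊥-elim (<-irrefl (trans (Bal-cnt bx t) (sym (Bal-cnt ba t)))
        (∑-strict (λ j → ⟦⟧-mono (free? L x t j) (free? L a t j) (λ (j∉ , e) → j∉ ,
            decidable-stable (lookup a j ≟ t) (λ ne → none (j , (j∉ , e) , ne))))
          (∈-allFin r) (≤-reflexive (trans (cong suc (⟦⟧-false (free? L x t r) (xr≢ ∘ proj₂)))
            (sym (⟦⟧-true (free? L a t r) (r∉L , refl)))))))
      swapping (yes (j , (j∉L , xj≡t) , aj≢t)) = by (f x ≟ f (swap r j x))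
        where
        r≢j : r ≢ j
        r≢j refl = xr≢ xj≡t
        pointwise : ∀ l → ⟦ differs? (swap r j x) l ⟧ ≤ ⟦ differs? x l ⟧
        pointwise l = ⟦⟧-mono (differs? (swap r j x) l) (differs? x l) (λ ne e → ne (same (l FinP.≟ r) (l FinP.≟ j) e))
          where
          same : Dec (l ≡ r) → Dec (l ≡ j) → lookup x l ≡ lookup a l → lookup (swap r j x) l ≡ lookup a l
          same (yes refl) _          e = trans (lookup-swapˡ r j x) xj≡t
          same (no _)     (yes refl) e = ⊥-elim (aj≢t (trans (sym e) xj≡t))
          same (no l≢r)   (no l≢j)   e = trans (lookup-swap-other x l≢r l≢j) e
        fewer : mismatch (swap r j x) < mismatch x
        fewer = ∑-strict pointwise (∈-allFin r) (≤-reflexive (trans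
          (cong suc (⟦⟧-false (differs? (swap r j x) r) (λ ne → ne (trans (lookup-swapˡ r j x) xj≡t))))
          (sym (⟦⟧-true (differs? x r) xr≢))))
        by : Dec (f x ≡ f (swap r j x)) → Asymmetry L m f
        by (no ne) = r , j , x , r≢j , r∉L , j∉L , bx , ne
        by (yes e) = go k (Bal-swap r≢j r∉L j∉L bx) (<-≤-trans fewer mk) (λ e′ → fa≢fx (trans e′ (sym e)))

  -- Averaging over the coordinates of a block.

  module _ {L : List (Fin n)} {m : ℕ} {S : Vec Carrier n → Set} (S? : ∀ x → Dec (S x)) (S⇒Bal : ∀ {x} → S x → Bal L m x) (e : Fin n) where

    followers : Assignment n → ℕ
    followers ps = ∑ (vecs n) (λ x → ⟦ S? x ×-dec Follows? e ps x ⟧)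

    sum-followers : ∀ {G : Fin n → Set} (G? : ∀ r → Dec (G r)) σ ps →
      ∑ (allFin n) (λ r → ⟦ G? r ⟧ * followers ((r , σ) ∷ ps))
      ≡ ∑ (vecs n) (λ x → ⟦ S? x ×-dec Follows? e ps x ⟧ * ∑ (allFin n) (λ r → ⟦ G? r ×-dec (lookup x r ≟ (lookup x e ⊕ σ)) ⟧))
    sum-followers G? σ ps = begin
      ∑ (allFin n) (λ r → ⟦ G? r ⟧ * followers ((r , σ) ∷ ps))
        ≡⟨ ∑-cong (allFin n) (λ r → sym (∑-*ˡ (vecs n) ⟦ G? r ⟧ _)) ⟩
      ∑ (allFin n) (λ r → ∑ (vecs n) (λ x → ⟦ G? r ⟧ * ⟦ S? x ×-dec Follows? e ((r , σ) ∷ ps) x ⟧))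
        ≡⟨ ∑-swap (allFin n) (vecs n) _ ⟩
      ∑ (vecs n) (λ x → ∑ (allFin n) (λ r → ⟦ G? r ⟧ * ⟦ S? x ×-dec Follows? e ((r , σ) ∷ ps) x ⟧))
        ≡⟨ ∑-cong (vecs n) (λ x → trans (∑-cong (allFin n) (pointwise x)) (∑-*ˡ (allFin n) ⟦ S? x ×-dec Follows? e ps x ⟧ _)) ⟩
      ∑ (vecs n) (λ x → ⟦ S? x ×-dec Follows? e ps x ⟧ * ∑ (allFin n) (λ r → ⟦ G? r ×-dec (lookup x r ≟ (lookup x e ⊕ σ)) ⟧)) ∎
      where
      open ≡-Reasoning
      pointwise : ∀ x r → ⟦ G? r ⟧ * ⟦ S? x ×-dec Follows? e ((r , σ) ∷ ps) x ⟧
        ≡ ⟦ S? x ×-dec Follows? e ps x ⟧ * ⟦ G? r ×-dec (lookup x r ≟ (lookup x e ⊕ σ)) ⟧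
      pointwise x r = trans (sym (⟦×⟧ (G? r) (S? x ×-dec Follows? e ((r , σ) ∷ ps) x))) (trans
        (⟦⟧-cong (G? r ×-dec (S? x ×-dec Follows? e ((r , σ) ∷ ps) x))
          ((S? x ×-dec Follows? e ps x) ×-dec (G? r ×-dec (lookup x r ≟ (lookup x e ⊕ σ))))
          (λ { (g , s , p ∷ ps) → (s , ps) , g , p }) (λ { ((s , ps) , g , p) → g , s , p ∷ ps }))
        (⟦×⟧ (S? x ×-dec Follows? e ps x) (G? r ×-dec (lookup x r ≟ (lookup x e ⊕ σ)))))

    -- After exchanging the sums, a point `x` contributes once for every free `r` holding
    -- `lookup x e ⊕ σ`, and balance makes that number `m`.
    followers-all : ∀ σ ps → ∑ (allFin n) (λ r → ⟦ ¬? (r ∈? L) ⟧ * followers ((r , σ) ∷ ps)) ≡ m * followers ps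
    followers-all σ ps = trans (sum-followers (λ r → ¬? (r ∈? L)) σ ps)
      (trans (∑-cong (vecs n) (λ x → by x (S? x ×-dec Follows? e ps x))) (∑-*ˡ (vecs n) m _))
      where
      by : ∀ x (h : Dec (S x × Follows e ps x)) → ⟦ h ⟧ * cnt L x (lookup x e ⊕ σ) ≡ m * ⟦ h ⟧
      by x (yes (s , _)) = trans (*-comm 1 _) (cong (_* 1) (Bal-cnt (S⇒Bal s) (lookup x e ⊕ σ)))
      by x (no _)        = sym (*-zeroʳ m)

    -- Excluding `W` removes at most `length W` of the `m` choices that each point offers.
    followers-outside : ∀ σ ps W → (m ∸ length W) * followers ps
      ≤ ∑ (allFin n) (λ r → ⟦ ¬? (r ∈? L) ×-dec ¬? (r ∈? W) ⟧ * followers ((r , σ) ∷ ps))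
    followers-outside σ ps W = begin
      (m ∸ length W) * followers ps                                                            ≡⟨ sym (∑-*ˡ (vecs n) (m ∸ length W) _) ⟩
      ∑ (vecs n) (λ x → (m ∸ length W) * ⟦ S? x ×-dec Follows? e ps x ⟧)                       ≤⟨ ∑-mono (vecs n) (λ x → by x (S? x ×-dec Follows? e ps x)) ⟩
      ∑ (vecs n) (λ x → ⟦ S? x ×-dec Follows? e ps x ⟧ * ∑ (allFin n) (λ r → ⟦ G? r ×-dec (lookup x r ≟ (lookup x e ⊕ σ)) ⟧))
        ≡⟨ sym (sum-followers G? σ ps) ⟩
      ∑ (allFin n) (λ r → ⟦ G? r ⟧ * followers ((r , σ) ∷ ps))                                 ∎
      where
      open ≤-Reasoning
      G? : ∀ r → Dec (r ∉ L × r ∉ W)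
      G? r = ¬? (r ∈? L) ×-dec ¬? (r ∈? W)
      enough : ∀ x → S x → ∀ t → m ∸ length W ≤ ∑ (allFin n) (λ r → ⟦ G? r ×-dec (lookup x r ≟ t) ⟧)
      enough x s t = m≤n+o⇒m∸n≤o m (length W) (begin
        m                                                                              ≡⟨ sym (Bal-cnt (S⇒Bal s) t) ⟩
        cnt L x t                                                                      ≤⟨ ∑-mono (allFin n) (λ r → pointwise r (r ∈? W)) ⟩
        ∑ (allFin n) (λ r → ⟦ r ∈? W ⟧ + ⟦ G? r ×-dec (lookup x r ≟ t) ⟧)               ≡⟨ ∑-+ (allFin n) _ _ ⟩
        ∑ (allFin n) (λ r → ⟦ r ∈? W ⟧) + ∑ (allFin n) (λ r → ⟦ G? r ×-dec (lookup x r ≟ t) ⟧) ≤⟨ +-monoˡ-≤ _ (∑-∈≤length W) ⟩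
        length W + ∑ (allFin n) (λ r → ⟦ G? r ×-dec (lookup x r ≟ t) ⟧)                 ∎)
        where
        pointwise : ∀ r (h : Dec (r ∈ W)) → ⟦ free? L x t r ⟧ ≤ ⟦ h ⟧ + ⟦ (¬? (r ∈? L) ×-dec ¬? h) ×-dec (lookup x r ≟ t) ⟧
        pointwise r (yes _) = ≤-trans (⟦⟧≤1 (free? L x t r)) (m≤m+n 1 _)
        pointwise r (no r∉) = ⟦⟧-mono (free? L x t r) ((¬? (r ∈? L) ×-dec ¬? (no r∉)) ×-dec (lookup x r ≟ t))
          (λ (r∉L , p) → (r∉L , r∉) , p)
      by : ∀ x (h : Dec (S x × Follows e ps x)) → (m ∸ length W) * ⟦ h ⟧
        ≤ ⟦ h ⟧ * ∑ (allFin n) (λ r → ⟦ G? r ×-dec (lookup x r ≟ (lookup x e ⊕ σ)) ⟧)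
      by x (yes (s , _)) = ≤-trans (≤-reflexive (*-comm _ 1)) (*-monoʳ-≤ 1 (enough x s (lookup x e ⊕ σ)))
      by x (no _)        = ≤-reflexive (*-zeroʳ (m ∸ length W))

  -- The blocks at `u` and `u′` are weighted by the numbers of their followers; exchanging the two
  -- coordinates compares the weights.
  sizeF-swap : ∀ {L m} {u u′ : Fin n} {ps} → u ≢ u′ → u ∉ L → u′ ∉ L → u ∉ dom ps → u′ ∉ dom ps →
    sizeF L m u ps ≤ sizeF L m u′ ps
  sizeF-swap {n} {L} {m} {u} {u′} {ps} u≢ u∉ u′∉ u∉ps u′∉ps =
    ∑-injection (λ x → Bal? L m x ×-dec Follows? u ps x) (λ x → Bal? L m x ×-dec Follows? u′ ps x) _≟ᵛ_
      (allVecs-unique n) (allVecs-complete n) (swap u u′)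
      (λ {x} (b , fl) → Bal-swap u≢ u∉ u′∉ b , All.tabulate (λ {p} p∈ → trans
        (lookup-swap-other x (λ e → u∉ps (subst (_∈ dom ps) e (∈-map⁺ proj₁ p∈))) (λ e → u′∉ps (subst (_∈ dom ps) e (∈-map⁺ proj₁ p∈))))
        (trans (All.lookup fl p∈) (cong (_⊕ proj₂ p) (sym (lookup-swapʳ x u≢))))))
      (λ {x} {x′} _ _ eq → trans (sym (swap-involutive x u≢)) (trans (cong (swap u u′) eq) (swap-involutive x′ u≢)))

  ∑-filter-≢ : ∀ xs c (g : Carrier → ℕ) →
    ∑ xs g ≡ ∑ (filter (λ σ → ¬? (σ ≟ c)) xs) g + ∑ xs (λ σ → ⟦ σ ≟ c ⟧) * g c
  ∑-filter-≢ []       c g = refl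
  ∑-filter-≢ (x ∷ xs) c g with x ≟ c
  ... | yes refl = trans (cong (g x +_) (∑-filter-≢ xs c g))
          (solve 3 (λ a b e → a :+ (b :+ e) := b :+ (a :+ e)) refl (g x) (∑ (filter (λ σ → ¬? (σ ≟ x)) xs) g) (∑ xs (λ σ → ⟦ σ ≟ x ⟧) * g x))
    where open NatSolver
  ... | no _ = trans (cong (g x +_) (∑-filter-≢ xs c g)) (sym (+-assoc (g x) _ _))

  nonzero-elems : List Carrier
  nonzero-elems = filter (λ σ → ¬? (σ ≟ 0#)) elems

  ∑-elems : ∀ g → ∑ elems g ≡ ∑ nonzero-elems g + g 0#
  ∑-elems g = trans (∑-filter-≢ elems 0# g) (cong (∑ nonzero-elems g +_)
    (trans (cong (_* g 0#) (∑-unique≡1 (_≟ 0#) unique (λ e e′ → trans e (sym e′)) (complete 0#) refl)) (*-identityˡ (g 0#))))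

  nonzero-elems-length : suc (length nonzero-elems) ≡ card
  nonzero-elems-length = sym (trans (sym (∑-one elems)) (trans (∑-elems (λ _ → 1))
    (trans (cong (_+ 1) (∑-one nonzero-elems)) (+-comm _ 1))))

  shift-once : ∀ y t → ∑ nonzero-elems (λ σ → ⟦ (y ⊕ σ) ≟ t ⟧) + ⟦ (y ⊕ 0#) ≟ t ⟧ ≡ 1
  shift-once y t = trans (sym (∑-elems (λ σ → ⟦ (y ⊕ σ) ≟ t ⟧)))
    (∑-unique≡1 (λ σ → (y ⊕ σ) ≟ t) unique (λ e e′ → ⊕-cancelˡ y (trans e (sym e′))) (complete (t ⊝ y)) (⊕-⊝ t y))

  -- Induction on the number of copies.

  module _ (r : ℕ) (card≡ : card ≡ suc (suc r)) where

    -- The quantifier over `L` lets an induction step freeze a further block; those over `d` and `f`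
    -- let it pass to a leading coefficient.
    Bound : ℕ → Set
    Bound m = ∀ {n d} {L : List (Fin n)} {f} → Deg (suc d) f → Alive L m f [] →
      num r d * (m ∸ loss r d) * size L m ≤ nonzeros L m f * (den r d * m)

    -- The induction hypothesis is applied to the leading coefficient; the factor `1 - j/q` lost in
    -- `y` is recovered from its lower degree by `num-drop`.
    block-bound : ∀ {m d L} {f : Fun n} {e ps} → Bound m → Block L ((e , 0#) ∷ ps) → Deg (suc d) f →
      (∃[ a ] (Bal L (suc m) a × f a ≢ 0# × Follows e ps a)) →
      ∃[ j ] (num r d * (m ∸ loss r (d ∸ j)) * sizeF L (suc m) e ps ≤ nonzerosF L (suc m) f e ps * (den r d * m)
        × (j ≡ 0 → Flat L m f ((e , 0#) ∷ ps)))
    block-bound {n = n} {m} {d} {L} {f} {e} {ps} ih block df al with block-restriction block m df al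
    ... | j , g , j<q , dg , alg , many , flat with j ≤? d
    -- For `j > d` the degree bound would make the leading coefficient zero, yet it is alive.
    ...   | no j≰d = ⊥-elim (proj₁ (proj₂ (proj₂ alg)) (Deg0⇒≡0 (subst (λ D → Deg D g) (m≤n⇒m∸n≡0 (≰⇒> j≰d)) dg) _))
    ...   | yes j≤d = j , bound , flat
      where
      open ≤-Reasoning
      open NatSolver
      q = suc (suc r)
      L′ = dom ((e , 0#) ∷ ps) ++ L
      a = num r d
      b = den r d
      a′ = num r (d ∸ j)
      b′ = den r (d ∸ j)
      l = m ∸ loss r (d ∸ j)
      T = sizeF L (suc m) e ps
      N = nonzerosF L (suc m) f e ps
      s = size L′ m
      z = nonzeros L′ m g
      j≤s : j ≤ suc r
      j≤s = s≤s⁻¹ (subst (suc j ≤_) card≡ j<q)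
      bound : a * l * T ≤ N * (b * m)
      bound = *-cancelˡ-≤ (q * b′) {{m*n≢0 q b′ {{_}} {{m^n≢0 q (suc ((d ∸ j) / suc r))}}}} (begin
        q * b′ * (a * l * T)                ≤⟨ *-monoʳ-≤ (q * b′) (*-monoʳ-≤ (a * l) (subst (λ c → T ≤ c * s) card≡ (sizeF≤ block m))) ⟩
        q * b′ * (a * l * (q * s))          ≡⟨ solve 5 (λ q b a l s → q :* b :* (a :* l :* (q :* s)) := q :* a :* b :* (l :* (q :* s))) refl q b′ a l s ⟩
        q * a * b′ * (l * (q * s))          ≤⟨ *-monoˡ-≤ (l * (q * s)) (num-drop r d j j≤d j≤s) ⟩
        (q ∸ j) * a′ * b * (l * (q * s))    ≡⟨ solve 6 (λ k a b l q s → k :* a :* b :* (l :* (q :* s)) := k :* b :* q :* (a :* l :* s)) refl (q ∸ j) a′ b l q s ⟩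
        (q ∸ j) * b * q * (a′ * l * s)      ≤⟨ *-monoʳ-≤ ((q ∸ j) * b * q) (ih (subst (λ D → Deg D g) (+-∸-assoc 1 j≤d) dg) alg) ⟩
        (q ∸ j) * b * q * (z * (b′ * m))    ≡⟨ solve 6 (λ k b q z c m → k :* b :* q :* (z :* (c :* m)) := q :* c :* (b :* m) :* (k :* z)) refl (q ∸ j) b q z b′ m ⟩
        q * b′ * (b * m) * ((q ∸ j) * z)    ≤⟨ *-monoʳ-≤ (q * b′ * (b * m)) (subst (λ c → (c ∸ j) * z ≤ N) card≡ many) ⟩
        q * b′ * (b * m) * N                ≡⟨ solve 4 (λ t b m N → t :* (b :* m) :* N := t :* (N :* (b :* m))) refl (q * b′) b m N ⟩
        q * b′ * (N * (b * m))              ∎)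

    module Step {L : List (Fin n)} {m d : ℕ} {f : Fun n} {u u′ : Fin n} {w a₀ : Vec Carrier n}
      (ih : Bound m) (df : Deg (suc d) f)
      (u≢u′ : u ≢ u′) (u∉L : u ∉ L) (u′∉L : u′ ∉ L) (bw : Bal L (suc m) w) (fw≢ : f w ≢ f (swap u u′ w))
      (ba₀ : Bal L (suc m) a₀) (fa₀≢0 : f a₀ ≢ 0#) (big : suc d + (3 + r) ≤ suc m)
      where

      v = lookup w u
      v′ = lookup w u′

      difference : ∃[ h ] (Deg (suc d ∸ 1) h × (∀ x → f (put (two u v′ u′ v) x) ≡ f (put (two u v u′ v′) x) ⊕ h x))
      difference = Deg-difference (put (two u v′ u′ v)) (put (two u v u′ v′)) (two-differs u u′ v v′) df

      -- Where `u` holds `v` and `u′` holds `v′`, the swap is a substitution of constants. So the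
      -- change of `f` under the swap is given there by a function of lower degree, to which
      -- `Alive-extend` applies.
      h : Fun n
      h = proj₁ difference

      h-eq : ∀ {x} → lookup x u ≡ v → lookup x u′ ≡ v′ → f (put (two u v′ u′ v) x) ≡ f x ⊕ h x
      h-eq {x} xu xu′ = trans (proj₂ (proj₂ difference) x) (cong (λ z → f z ⊕ h x) (put-id (two u v u′ v′) x (xu ∷ xu′ ∷ [])))

      hw≢0 : h w ≢ 0#
      hw≢0 hw≡0 = fw≢ (sym (trans (h-eq refl refl) (trans (cong (f w ⊕_) hw≡0) (⊕-identityʳ (f w)))))

      constraints : Carrier → Vec Carrier n → Assignment n → Assignment n
      constraints y x ps = line y ps ++ two u (lookup x u) u′ (lookup x u′)

      dom-constraints : ∀ y x ps → dom (constraints y x ps) ≡ dom ps ++ u ∷ u′ ∷ []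
      dom-constraints y x ps = trans (ListP.map-++ proj₁ (line y ps) _) (cong (_++ u ∷ u′ ∷ []) (dom-line y ps))

      -- `σs` lists the offsets still to be placed. `alive` and `alive′` keep a nonzero of `f` on
      -- each of the two blocks, and `aliveʰ` keeps a point at which the swap changes `f`. For empty
      -- `σs`, `once` becomes `full`.
      record Partial (σs : List Carrier) (ps : Assignment n) : Set where
        field
          distinct : Unique (dom ps)
          avoids   : All (λ l → l ∉ L × l ≢ u × l ≢ u′) (dom ps)
          once     : ∀ y t → ∑ σs (λ σ → ⟦ (y ⊕ σ) ≟ t ⟧) + mult (line y ((u , 0#) ∷ ps)) t ≡ 1
          short    : length σs + length ps ≤ suc r
          alive    : Alive L (suc m) f (constraints (lookup a₀ u) a₀ ps)
          alive′   : Alive L (suc m) f (constraints (lookup a₀ u′) a₀ ps)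
          aliveʰ   : Alive L (suc m) h (constraints v w ps)

      ∉-dom : ∀ {ps l} → All (λ l → l ∉ L × l ≢ u × l ≢ u′) (dom ps) → l ≡ u ⊎ l ≡ u′ → All (l ≢_) (dom ps)
      ∉-dom av (inj₁ refl) = All.map (λ (_ , ≢u , _) e → ≢u (sym e)) av
      ∉-dom av (inj₂ refl) = All.map (λ (_ , _ , ≢u′) e → ≢u′ (sym e)) av

      complete-block : ∀ {ps e} → Partial [] ps → e ≡ u ⊎ e ≡ u′ → Block L ((e , 0#) ∷ ps)
      complete-block p e≡ = record
        { distinct = ∉-dom (Partial.avoids p) e≡ ∷ Partial.distinct p
        ; fresh    = e∉ e≡ ∷ All.map proj₁ (Partial.avoids p)
        ; full     = Partial.once p
        }
        where
        e∉ : ∀ {e} → e ≡ u ⊎ e ≡ u′ → e ∉ L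
        e∉ (inj₁ refl) = u∉L
        e∉ (inj₂ refl) = u′∉L

      -- If f were flat on both blocks, then moving first along the block at u and back along the block
      -- at u′ would exchange the values v and v′ without changing f.
      not-both-flat : ∀ {ps} → Partial [] ps → Flat L m f ((u , 0#) ∷ ps) → Flat L m f ((u′ , 0#) ∷ ps) → ⊥
      not-both-flat {ps} p flat flat′ with Partial.aliveʰ p
      ... | a , ba , ha≢0 , agr = ha≢0 (⊕-cancelˡ (f a) (sym (begin
          f a ⊕ 0#                                        ≡⟨ ⊕-identityʳ (f a) ⟩
          f a                                             ≡⟨ cong f (sym (insert-erase blockᵘ agrᵘ)) ⟩
          f (put (line v bs) x₀)                          ≡⟨ flat (erase blockᵘ ba agrᵘ) v v′ ⟩
          f b                                             ≡⟨ cong f (sym (insert-erase blockᵘ′ agrᵇ)) ⟩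
          f (put (line v′ bs′) x₁)                        ≡⟨ flat′ (erase blockᵘ′ (insert blockᵘ v′ (erase blockᵘ ba agrᵘ)) agrᵇ) v′ v ⟩
          f (put (line v bs′) x₁)                         ≡⟨ cong f end ⟩
          f (put (two u v′ u′ v) a)                       ≡⟨ h-eq au au′ ⟩
          f a ⊕ h a                                       ∎)))
        where
        open ≡-Reasoning
        bs = (u , 0#) ∷ ps
        bs′ = (u′ , 0#) ∷ ps
        blockᵘ = complete-block p (inj₁ refl)
        blockᵘ′ = complete-block p (inj₂ refl)
        agr-ps : Agrees a (line v ps)
        agr-ps = AllP.++⁻ˡ (line v ps) agr
        au : lookup a u ≡ v
        au = All.head (AllP.++⁻ʳ (line v ps) agr)
        au′ : lookup a u′ ≡ v′
        au′ = All.head (All.tail (AllP.++⁻ʳ (line v ps) agr))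
        agrᵘ : Agrees a (line v bs)
        agrᵘ = trans au (sym (⊕-identityʳ v)) ∷ agr-ps
        u∉ps : u ∉ dom ps
        u∉ps = AllP.All¬⇒¬Any (∉-dom (Partial.avoids p) (inj₁ refl))
        u′∉ps : u′ ∉ dom ps
        u′∉ps = AllP.All¬⇒¬Any (∉-dom (Partial.avoids p) (inj₂ refl))
        u′∉bs : u′ ∉ dom bs
        u′∉bs (here e)  = u≢u′ (sym e)
        u′∉bs (there i) = u′∉ps i
        u∉bs′ : u ∉ dom bs′
        u∉bs′ (here e)  = u≢u′ e
        u∉bs′ (there i) = u∉ps i
        x₀ b x₁ c : Vec Carrier n
        x₀ = put (zeros bs) a
        b = put (line v′ bs) x₀
        x₁ = put (zeros bs′) b
        c = put (line v bs′) x₁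
        agrᵇ : Agrees b (line v′ bs′)
        agrᵇ = trans (off-line blockᵘ v′ x₀ u′∉bs) (trans (off-zeros blockᵘ a u′∉bs) (trans au′ (sym (⊕-identityʳ v′))))
          ∷ All.tail (line-agrees blockᵘ v′ x₀)
        end : c ≡ put (two u v′ u′ v) a
        end = agrees-ext {ps = two u v′ u′ v ++ line v ps}
          ( trans (off-line blockᵘ′ v x₁ u∉bs′) (trans (off-zeros blockᵘ′ b u∉bs′) (trans (All.head (line-agrees blockᵘ v′ x₀)) (⊕-identityʳ v′)))
          ∷ trans (All.head (line-agrees blockᵘ′ v x₁)) (⊕-identityʳ v)
          ∷ All.tail (line-agrees blockᵘ′ v x₁))
          ( VecP.lookup∘update u (a [ u′ ]≔ v) v′
          ∷ trans (VecP.lookup∘update′ (u≢u′ ∘ sym) (a [ u′ ]≔ v) v′) (VecP.lookup∘update u′ a v)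
          ∷ All.tabulate (λ {z} z∈ → trans (lookup-two u v′ u′ v a
                (λ e → u∉ps (subst₂ _∈_ e (dom-line v ps) (∈-map⁺ proj₁ z∈)))
                (λ e → u′∉ps (subst₂ _∈_ e (dom-line v ps) (∈-map⁺ proj₁ z∈)))) (All.lookup agr-ps z∈)))
          off
          where
          off : ∀ {l} → l ∉ dom (two u v′ u′ v ++ line v ps) → lookup c l ≡ lookup (put (two u v′ u′ v) a) l
          off {l} l∉ = trans (off-line blockᵘ′ v x₁ l∉bs′) (trans (off-zeros blockᵘ′ b l∉bs′)
              (trans (off-line blockᵘ v′ x₀ l∉bs) (trans (off-zeros blockᵘ a l∉bs) (sym (lookup-two u v′ u′ v a l≢u l≢u′)))))
            where
            l≢u : l ≢ u
            l≢u e = l∉ (here e)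
            l≢u′ : l ≢ u′
            l≢u′ e = l∉ (there (here e))
            l∉ps : l ∉ dom ps
            l∉ps i = l∉ (there (there (subst (l ∈_) (sym (dom-line v ps)) i)))
            l∉bs : l ∉ dom bs
            l∉bs (here e)  = l≢u e
            l∉bs (there i) = l∉ps i
            l∉bs′ : l ∉ dom bs′
            l∉bs′ (here e)  = l≢u′ e
            l∉bs′ (there i) = l∉ps i

      gain : ℕ
      gain = (m ∸ loss r d) + (m ∸ loss r (d ∸ 1))

      both : Assignment n → ℕ
      both ps = nonzerosF L (suc m) f u ps + nonzerosF L (suc m) f u′ ps

      -- By `not-both-flat` one of the two restrictions has positive degree in `y`, hence at most
      -- the loss of `d ∸ 1`; the other has at most the loss of `d`.
      finished : ∀ {ps} → Partial [] ps → num r d * gain * sizeF L (suc m) u ps ≤ both ps * (den r d * m)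
      finished {ps} p = go (block-bound ih (complete-block p (inj₁ refl)) df (follow (Partial.alive p)))
                           (block-bound ih (complete-block p (inj₂ refl)) df (follow′ (Partial.alive′ p)))
        where
        T = sizeF L (suc m) u ps
        T′ = sizeF L (suc m) u′ ps
        a = num r d
        Follow : Fin n → Set
        Follow e = ∃[ x ] (Bal L (suc m) x × f x ≢ 0# × Follows e ps x)
        follow : Alive L (suc m) f (constraints (lookup a₀ u) a₀ ps) → Follow u
        follow (x , bx , nz , agr) = x , bx , nz , All.map (λ e → trans e (cong (_⊕ _) (sym xu))) (AllP.map⁻ (AllP.++⁻ˡ (line _ ps) agr))
          where xu = All.head (AllP.++⁻ʳ (line (lookup a₀ u) ps) agr)
        follow′ : Alive L (suc m) f (constraints (lookup a₀ u′) a₀ ps) → Follow u′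
        follow′ (x , bx , nz , agr) = x , bx , nz , All.map (λ e → trans e (cong (_⊕ _) (sym xu′))) (AllP.map⁻ (AllP.++⁻ˡ (line _ ps) agr))
          where xu′ = All.head (All.tail (AllP.++⁻ʳ (line (lookup a₀ u′) ps) agr))
        T≤T′ : T ≤ T′
        T≤T′ = sizeF-swap u≢u′ u∉L u′∉L (AllP.All¬⇒¬Any (∉-dom (Partial.avoids p) (inj₁ refl)))
          (AllP.All¬⇒¬Any (∉-dom (Partial.avoids p) (inj₂ refl)))
        weaken : ∀ {i j T₁} {X : ℕ} → i ≤ j → T ≤ T₁ → a * (m ∸ loss r (d ∸ j)) * T₁ ≤ X → a * (m ∸ loss r (d ∸ i)) * T ≤ X
        weaken i≤j T≤ le = ≤-trans (*-mono-≤ (*-monoʳ-≤ a (∸-monoʳ-≤ m (loss-mono r (∸-monoʳ-≤ d i≤j)))) T≤) le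
        add : ∀ {i j X Y} → i + j ≡ 1 → a * (m ∸ loss r (d ∸ i)) * T ≤ X * (den r d * m) → a * (m ∸ loss r (d ∸ j)) * T ≤ Y * (den r d * m) →
          a * gain * T ≤ (X + Y) * (den r d * m)
        add {0} {1} {X} {Y} _ h₁ h₂ = begin
          a * ((m ∸ loss r d) + (m ∸ loss r (d ∸ 1))) * T                        ≡⟨ solve 4 (λ a x y t → a :* (x :+ y) :* t := a :* x :* t :+ a :* y :* t) refl a (m ∸ loss r d) (m ∸ loss r (d ∸ 1)) T ⟩
          a * (m ∸ loss r d) * T + a * (m ∸ loss r (d ∸ 1)) * T                  ≤⟨ +-mono-≤ h₁ h₂ ⟩
          X * (den r d * m) + Y * (den r d * m)                                  ≡⟨ sym (*-distribʳ-+ (den r d * m) X Y) ⟩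
          (X + Y) * (den r d * m)                                                ∎
          where
          open ≤-Reasoning
          open NatSolver
        add {1} {0} {X} {Y} _ h₁ h₂ = subst (λ z → a * gain * T ≤ z * (den r d * m)) (+-comm Y X) (add {0} {1} {Y} {X} refl h₂ h₁)
        go : ∃[ j ] (a * (m ∸ loss r (d ∸ j)) * T ≤ nonzerosF L (suc m) f u ps * (den r d * m) × (j ≡ 0 → Flat L m f ((u , 0#) ∷ ps))) →
          ∃[ j ] (a * (m ∸ loss r (d ∸ j)) * T′ ≤ nonzerosF L (suc m) f u′ ps * (den r d * m) × (j ≡ 0 → Flat L m f ((u′ , 0#) ∷ ps))) →
          a * gain * T ≤ both ps * (den r d * m)
        go (zero , _ , flat) (zero , _ , flat′) = ⊥-elim (not-both-flat p (flat refl) (flat′ refl))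
        go (suc j , le , _) (j′ , le′ , _) = add {1} {0} {nonzerosF L (suc m) f u ps} refl (weaken (s≤s z≤n) ≤-refl le) (weaken {j = j′} z≤n T≤T′ le′)
        go (zero , le , _) (suc j′ , le′ , _) = add {0} {1} {nonzerosF L (suc m) f u ps} refl le (weaken (s≤s z≤n) T≤T′ le′)

      -- The offsets are placed one at a time. On the left, each point keeps at least
      -- `suc m ∸ K r d` good choices; on the right, the sum runs over all free coordinates, `suc m`
      -- for each point, so bad choices only help.
      sample : ∀ σs {ps} → Partial σs ps →
        num r d * gain * (suc m ∸ K r d) ^ length σs * sizeF L (suc m) u ps ≤ both ps * suc m ^ length σs * (den r d * m)
      sample [] {ps} p = begin
        num r d * gain * 1 * sizeF L (suc m) u ps   ≡⟨ cong (_* sizeF L (suc m) u ps) (*-identityʳ (num r d * gain)) ⟩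
        num r d * gain * sizeF L (suc m) u ps       ≤⟨ finished p ⟩
        both ps * (den r d * m)                     ≡⟨ cong (_* (den r d * m)) (sym (*-identityʳ (both ps))) ⟩
        both ps * 1 * (den r d * m)                 ∎
        where open ≤-Reasoning
      sample (σ ∷ σs) {ps} p
        with Alive-extend (lookup a₀ u ⊕ σ) df (Partial.alive p) (fits (lookup a₀ u) a₀)
           | Alive-extend (lookup a₀ u′ ⊕ σ) df (Partial.alive′ p) (fits (lookup a₀ u′) a₀)
           | Alive-extend (v ⊕ σ) (Deg-mono (n≤1+n d) (proj₁ (proj₂ difference))) (Partial.aliveʰ p) (fits v w)
        where
        fits : ∀ y x → suc d + length (constraints y x ps) ≤ suc m
        fits y x = ≤-trans (+-monoʳ-≤ (suc d) (begin
          length (constraints y x ps)           ≡⟨ ListP.length-++ (line y ps) ⟩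
          length (line y ps) + 2                ≡⟨ cong (_+ 2) (ListP.length-map _ ps) ⟩
          length ps + 2                         ≤⟨ +-monoˡ-≤ 2 (≤-trans (m≤n+m (length ps) (suc (length σs))) (Partial.short p)) ⟩
          suc r + 2                             ≡⟨ +-comm (suc r) 2 ⟩
          3 + r                                 ∎)) big
          where open ≤-Reasoning
      ... | W₁ , short₁ , ext₁ | W₂ , short₂ , ext₂ | W₃ , short₃ , ext₃ = begin
        α * (κ * κ ^ k) * sizeF L (suc m) u ps
          ≡⟨ solve 4 (λ a x y t → a :* (x :* y) :* t := a :* y :* (x :* t)) refl α κ (κ ^ k) (sizeF L (suc m) u ps) ⟩
        α * κ ^ k * (κ * sizeF L (suc m) u ps)
          ≤⟨ *-monoʳ-≤ (α * κ ^ k) (≤-trans (*-monoˡ-≤ (sizeF L (suc m) u ps) (∸-monoʳ-≤ (suc m) W-short))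
               (followers-outside (Bal? L (suc m)) (λ b → b) u σ ps W)) ⟩
        α * κ ^ k * ∑ (allFin n) (λ l → ⟦ good? l ⟧ * sizeF L (suc m) u ((l , σ) ∷ ps))
          ≡⟨ sym (∑-*ˡ (allFin n) (α * κ ^ k) _) ⟩
        ∑ (allFin n) (λ l → α * κ ^ k * (⟦ good? l ⟧ * sizeF L (suc m) u ((l , σ) ∷ ps)))
          ≤⟨ ∑-mono (allFin n) (λ l → by l (good? l)) ⟩
        ∑ (allFin n) (λ l → (⟦ ¬? (l ∈? L) ⟧ * both ((l , σ) ∷ ps)) * (suc m ^ k * c))
          ≡⟨ ∑-*ʳ (allFin n) (suc m ^ k * c) _ ⟩
        ∑ (allFin n) (λ l → ⟦ ¬? (l ∈? L) ⟧ * both ((l , σ) ∷ ps)) * (suc m ^ k * c)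
          ≡⟨ cong (_* (suc m ^ k * c)) sum-both ⟩
        suc m * both ps * (suc m ^ k * c)
          ≡⟨ solve 4 (λ m b p c → m :* b :* (p :* c) := b :* (m :* p) :* c) refl (suc m) (both ps) (suc m ^ k) c ⟩
        both ps * (suc m * suc m ^ k) * c ∎
        where
        open ≤-Reasoning
        open NatSolver
        α = num r d * gain
        κ = suc m ∸ K r d
        k = length σs
        c = den r d * m
        W : List (Fin n)
        -- The origin of `K`: at most `d` coordinates where the new value would kill each of the
        -- three witnesses, at most `suc r` coordinates already chosen, and `u` and `u′`.
        W = W₁ ++ W₂ ++ W₃ ++ dom ps ++ u ∷ u′ ∷ []
        good? : ∀ l → Dec (l ∉ L × l ∉ W)
        good? l = ¬? (l ∈? L) ×-dec ¬? (l ∈? W)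
        W-short : length W ≤ K r d
        W-short = begin
          length W
            ≡⟨ trans (ListP.length-++ W₁) (cong (length W₁ +_) (trans (ListP.length-++ W₂) (cong (length W₂ +_)
                 (trans (ListP.length-++ W₃) (cong (length W₃ +_) (trans (ListP.length-++ (dom ps)) (cong (_+ 2) (ListP.length-map proj₁ ps)))))))) ⟩
          length W₁ + (length W₂ + (length W₃ + (length ps + 2)))
            ≤⟨ +-mono-≤ short₁ (+-mono-≤ short₂ (+-mono-≤ short₃ (+-monoˡ-≤ 2 (≤-trans (m≤n+m (length ps) (suc k)) (Partial.short p))))) ⟩
          d + (d + (d + (suc r + 2)))
            ≡⟨ solve 2 (λ d r → d :+ (d :+ (d :+ (con 1 :+ r :+ con 2))) := con 3 :* d :+ (con 3 :+ r)) refl d r ⟩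
          K r d ∎
        extend : ∀ {l} → l ∉ L × l ∉ W → Partial σs ((l , σ) ∷ ps)
        extend {l} (l∉L , l∉W) = record
          { distinct = AllP.¬Any⇒All¬ (dom ps) (λ i → l∉ (∈-++⁺ˡ i)) ∷ Partial.distinct p
          ; avoids   = (l∉L , (λ e → l∉ (∈-++⁺ʳ (dom ps) (here e))) , (λ e → l∉ (∈-++⁺ʳ (dom ps) (there (here e))))) ∷ Partial.avoids p
          ; once     = λ y t → trans
              (solve 4 (λ s o x z → s :+ (o :+ (x :+ z)) := x :+ s :+ (o :+ z)) refl
                (∑ σs (λ σ → ⟦ (y ⊕ σ) ≟ t ⟧)) ⟦ (y ⊕ 0#) ≟ t ⟧ ⟦ (y ⊕ σ) ≟ t ⟧ (mult (line y ps) t))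
              (Partial.once p y t)
          ; short    = ≤-trans (≤-reflexive (+-suc k (length ps))) (Partial.short p)
          ; alive    = ext₁ l∉L (l∉c (lookup a₀ u) a₀) (l∉W ∘ ∈-++⁺ˡ)
          ; alive′   = ext₂ l∉L (l∉c (lookup a₀ u′) a₀) (l∉W ∘ ∈-++⁺ʳ W₁ ∘ ∈-++⁺ˡ)
          ; aliveʰ   = ext₃ l∉L (l∉c v w) (l∉W ∘ ∈-++⁺ʳ W₁ ∘ ∈-++⁺ʳ W₂ ∘ ∈-++⁺ˡ)
          }
          where
          l∉ : l ∉ dom ps ++ u ∷ u′ ∷ []
          l∉ = l∉W ∘ ∈-++⁺ʳ W₁ ∘ ∈-++⁺ʳ W₂ ∘ ∈-++⁺ʳ W₃
          l∉c : ∀ y x → l ∉ dom (constraints y x ps)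
          l∉c y x i = l∉ (subst (l ∈_) (dom-constraints y x ps) i)
        by : ∀ l (g : Dec (l ∉ L × l ∉ W)) → α * κ ^ k * (⟦ g ⟧ * sizeF L (suc m) u ((l , σ) ∷ ps))
          ≤ (⟦ ¬? (l ∈? L) ⟧ * both ((l , σ) ∷ ps)) * (suc m ^ k * c)
        by l (no _)  = ≤-trans (≤-reflexive (*-zeroʳ (α * κ ^ k))) z≤n
        by l (yes g) = begin
          α * κ ^ k * (1 * sizeF L (suc m) u ((l , σ) ∷ ps))   ≡⟨ cong (α * κ ^ k *_) (*-identityˡ _) ⟩
          α * κ ^ k * sizeF L (suc m) u ((l , σ) ∷ ps)         ≤⟨ sample σs (extend g) ⟩
          both ((l , σ) ∷ ps) * suc m ^ k * c                  ≡⟨ *-assoc (both ((l , σ) ∷ ps)) _ c ⟩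
          both ((l , σ) ∷ ps) * (suc m ^ k * c)                ≡⟨ cong (_* (suc m ^ k * c)) (sym (trans (cong (_* both ((l , σ) ∷ ps)) (⟦⟧-true (¬? (l ∈? L)) (proj₁ g))) (*-identityˡ _))) ⟩
          (⟦ ¬? (l ∈? L) ⟧ * both ((l , σ) ∷ ps)) * (suc m ^ k * c) ∎
        sum-both : ∑ (allFin n) (λ l → ⟦ ¬? (l ∈? L) ⟧ * both ((l , σ) ∷ ps)) ≡ suc m * both ps
        sum-both = trans (∑-cong (allFin n) (λ l → *-distribˡ-+ ⟦ ¬? (l ∈? L) ⟧ _ _)) (trans (∑-+ (allFin n) _ _) (trans
          (cong₂ _+_ (followers-all (λ x → Bal? L (suc m) x ×-dec ¬? (f x ≟ 0#)) proj₁ u σ ps)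
                     (followers-all (λ x → Bal? L (suc m) x ×-dec ¬? (f x ≟ 0#)) proj₁ u′ σ ps))
          (sym (*-distribˡ-+ (suc m) (nonzerosF L (suc m) f u ps) _))))

      start : Partial nonzero-elems []
      start = record
        { distinct = []
        ; avoids   = []
        ; once     = λ y t → trans (cong (∑ nonzero-elems (λ σ → ⟦ (y ⊕ σ) ≟ t ⟧) +_) (+-identityʳ _)) (shift-once y t)
        ; short    = ≤-reflexive (trans (+-identityʳ _) (suc-injective (trans nonzero-elems-length card≡)))
        ; alive    = a₀ , ba₀ , fa₀≢0 , refl ∷ refl ∷ []
        ; alive′   = a₀ , ba₀ , fa₀≢0 , refl ∷ refl ∷ []
        ; aliveʰ   = w , bw , hw≢0 , refl ∷ refl ∷ []
        }

      -- Before any offset is placed, following is vacuous, so the counts at `u` and `u′` are both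
      -- the full number of nonzeros.
      conclusion : num r d * gain * (suc m ∸ K r d) ^ suc r * size L (suc m)
        ≤ (nonzeros L (suc m) f + nonzeros L (suc m) f) * suc m ^ suc r * (den r d * m)
      conclusion = subst₂ _≤_
        (cong₂ (λ k t → num r d * gain * (suc m ∸ K r d) ^ k * t) len
          (∑-cong (vecs n) (λ x → ⟦⟧-cong (Bal? L (suc m) x ×-dec Follows? u [] x) (Bal? L (suc m) x) proj₁ (_, []))))
        (cong₂ (λ k t → t * suc m ^ k * (den r d * m)) len (cong₂ _+_ (drop-Follows u) (drop-Follows u′)))
        (sample nonzero-elems start)
        where
        len : length nonzero-elems ≡ suc r
        len = suc-injective (trans nonzero-elems-length card≡)
        drop-Follows : ∀ e → nonzerosF L (suc m) f e [] ≡ nonzeros L (suc m) f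
        drop-Follows e = ∑-cong (vecs n) (λ x → ⟦⟧-cong ((Bal? L (suc m) x ×-dec ¬? (f x ≟ 0#)) ×-dec Follows? e [] x)
          (Bal? L (suc m) x ×-dec ¬? (f x ≟ 0#)) proj₁ (_, []))

    bound : ∀ m → Bound m
    bound zero {d = d} {L} {f} df al = ≤-trans (≤-reflexive (trans (cong (_* size L 0) (trans (cong (num r d *_) (0∸n≡0 (loss r d))) (*-zeroʳ (num r d)))) refl)) z≤n
    bound (suc m) {n} {d} {L} {f} df (a , ba , fa≢0 , _)
      -- Without a zero on the slice the density is 1. With one, `f` takes two distinct values there
      -- and `asymmetry` applies.
      with ∃Vec? (λ x → Bal? L (suc m) x ×-dec (f x ≟ 0#))
    ... | no none = begin
      num r d * (suc m ∸ loss r d) * size L (suc m)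
        ≤⟨ *-mono-≤ (*-mono-≤ (num≤den r d) (m∸n≤m (suc m) (loss r d))) (∑-mono (vecs n) (λ x → ⟦⟧-mono (Bal? L (suc m) x)
             (Bal? L (suc m) x ×-dec ¬? (f x ≟ 0#)) (λ b → b , λ z → none (x , b , z)))) ⟩
      den r d * suc m * nonzeros L (suc m) f   ≡⟨ *-comm (den r d * suc m) _ ⟩
      nonzeros L (suc m) f * (den r d * suc m) ∎
      where open ≤-Reasoning
    ... | yes (x , bx , fx≡0) with asymmetry ba bx (λ e → fa≢0 (trans e fx≡0))
    ...   | u , u′ , w , u≢u′ , u∉L , u′∉L , bw , fw≢ = by d df (loss r d ≤? m)
      where
      by : ∀ d → Deg (suc d) f → Dec (loss r d ≤ m) →
        num r d * (suc m ∸ loss r d) * size L (suc m) ≤ nonzeros L (suc m) f * (den r d * suc m)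
      -- Here `loss` is at least `suc m`, and truncation makes the left side zero.
      by d df (no ≰m) = ≤-trans (≤-reflexive (cong (_* size L (suc m)) (trans (cong (num r d *_) (m≤n⇒m∸n≡0 (≰⇒> ≰m))) (*-zeroʳ (num r d))))) z≤n
      -- In degree 0 the difference under a swap is the zero function, contradicting the asymmetry.
      by zero df (yes _) = ⊥-elim (fw≢ (sym (trans (eq w) (trans (cong₂ _⊕_ (cong f (put-id (two u (lookup w u) u′ (lookup w u′)) w (refl ∷ refl ∷ []))) (Deg0⇒≡0 dh w)) (⊕-identityʳ (f w))))))
        where
        diff = Deg-difference (put (two u (lookup w u′) u′ (lookup w u))) (put (two u (lookup w u) u′ (lookup w u′)))
                 (two-differs u u′ (lookup w u) (lookup w u′)) df
        dh = proj₁ (proj₂ diff)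
        eq = proj₂ (proj₂ diff)
      by (suc d) df (yes ≤m) = combine {s = suc r} {k = K r (suc d)} {a = num r (suc d)} {b = den r (suc d)} {N = nonzeros L (suc m) f} {X = size L (suc m)} {C′ = loss r d} (loss-suc r d) ≤m
        (Step.conclusion (bound m) df u≢u′ u∉L u′∉L bw fw≢ ba fa≢0 room)
        where
        open ≤-Reasoning
        open NatSolver
        -- Room for the partners in `Alive-extend`: the degree bound plus at most `3 + r`
        -- constraints. It follows from the assumption that `loss` is at most `m`.
        room : suc (suc d) + (3 + r) ≤ suc m
        room = s≤s (begin
          suc d + (3 + r)                          ≤⟨ +-monoˡ-≤ (3 + r) (m≤n*m (suc d) 3) ⟩
          K r (suc d)                              ≤⟨ m≤n*m (K r (suc d)) (suc r) ⟩
          suc r * K r (suc d)                      ≤⟨ m≤n*m _ 2 ⟩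
          2 * (suc r * K r (suc d))                ≤⟨ m≤n+m _ 2 ⟩
          2 + 2 * (suc r * K r (suc d))            ≤⟨ m≤n*m _ (suc d) ⟩
          loss r (suc d)                           ≤⟨ ≤m ⟩
          m                                        ∎)

  -- Polynomials and the balanced multislice.

  Deg-ext : ∀ {D} {f g : Fun n} → (∀ x → g x ≡ f x) → Deg D f → Deg D g
  Deg-ext e df = addᵈ df (zeroᵈ (λ _ → refl)) (λ x → trans (e x) (sym (⊕-identityʳ _)))

  Deg-pow : ∀ {D} {g : Fun n} i k → Deg D g → Deg (k + D) (λ x → powF F (lookup x i) k ⊗ g x)
  Deg-pow i zero    dg = Deg-ext (λ x → ⊗-identityˡ _) dg
  Deg-pow i (suc k) dg = varᵈ i (Deg-pow i k dg) (λ x → ⊗-assoc _ _ _)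

  monomial : ∀ {k} → Vec ℕ k → Vec Carrier k → Carrier
  monomial e x = Vec.foldr _ _⊗_ 1# (Vec.zipWith (powF F) x e)

  -- The projection `π` with its coordinates `ρ` keeps the ambient dimension fixed while the
  -- recursion shortens the exponent vector.
  Deg-monomial : ∀ {k} (e : Vec ℕ k) (ρ : Fin k → Fin n) (π : Vec Carrier n → Vec Carrier k) →
    (∀ x i → lookup (π x) i ≡ lookup x (ρ i)) → Deg (suc (Vec.sum e)) (λ x → monomial e (π x))
  Deg-monomial []      ρ π h = constᵈ 1# (λ x → empty (π x))
    where
    empty : ∀ v → monomial [] v ≡ 1#
    empty [] = refl
  Deg-monomial (k ∷ e) ρ π h = subst (λ D → Deg D (λ x → monomial (k ∷ e) (π x))) (+-suc k (Vec.sum e))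
    (Deg-ext (λ x → trans (uncons (π x)) (cong (λ z → powF F z k ⊗ monomial e (Vec.tail (π x))) (trans (head-lookup (π x)) (h x zero))))
      (Deg-pow (ρ zero) k (Deg-monomial e (ρ ∘ suc) (Vec.tail ∘ π) (λ x i → trans (tail-lookup (π x) i) (h x (suc i))))))
    where
    uncons : ∀ v → monomial (k ∷ e) v ≡ powF F (Vec.head v) k ⊗ monomial e (Vec.tail v)
    uncons (_ ∷ _) = refl
    head-lookup : ∀ {k} (v : Vec Carrier (suc k)) → Vec.head v ≡ lookup v zero
    head-lookup (_ ∷ _) = refl
    tail-lookup : ∀ {k} (v : Vec Carrier (suc k)) i → lookup (Vec.tail v) i ≡ lookup v (suc i)
    tail-lookup (_ ∷ _) i = refl

  Deg-eval : ∀ {d} (P : Poly F n) → DegreeAtMost F d P → Deg (suc d) (eval F P)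
  Deg-eval []              []         = zeroᵈ (λ _ → refl)
  Deg-eval (term c e ∷ P) (le ∷ les) =
    addᵈ (Deg-scale c (Deg-mono (s≤s le) (Deg-monomial e (λ i → i) (λ x → x) (λ _ _ → refl)))) (Deg-eval P les) (λ _ → refl)

  ∑-tabulate : ∀ {B : Set} {k} (a : Vec Carrier k) (h : Fin k → B) {G : B → ℕ} {g : Carrier → ℕ} →
    (∀ i → G (h i) ≡ g (lookup a i)) → ∑ (List.tabulate h) G ≡ ∑ (Vec.toList a) g
  ∑-tabulate []      h e = refl
  ∑-tabulate (_ ∷ a) h e = cong₂ _+_ (e zero) (∑-tabulate a (h ∘ suc) (e ∘ suc))

  count≡cnt : ∀ σ (a : Vec Carrier n) → count F σ a ≡ cnt [] a σ
  count≡cnt σ a = trans (length-filter-∑ (_≟ σ) (Vec.toList a))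
    (sym (∑-tabulate a (λ i → i) (λ i → ⟦⟧-cong (free? [] a σ i) (lookup a i ≟ σ) proj₂ (λ e → (λ ()) , e))))

  module _ {r : ℕ} (m : ℕ) (card≡ : card ≡ suc (suc r)) where

    private
      N : ℕ
      N = m * suc (suc r)

    cnt≡⇒ : ∀ (a : Vec Carrier N) {σ} → cnt [] a σ ≡ m → count F σ a * card ≡ N
    cnt≡⇒ a {σ} e = cong₂ _*_ (trans (count≡cnt σ a) e) card≡

    ⇒cnt≡ : ∀ (a : Vec Carrier N) {σ} → count F σ a * card ≡ N → cnt [] a σ ≡ m
    ⇒cnt≡ a {σ} e = trans (sym (count≡cnt σ a)) (*-cancelʳ-≡ _ m (suc (suc r)) (trans (cong (count F σ a *_) (sym card≡)) e))

    size≡ : length (filter (inMultislice? F N) (vecs N)) ≡ size {N} [] m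
    size≡ = trans (length-filter-∑ (inMultislice? F N) (vecs N)) (∑-cong (vecs N) (λ x →
      ⟦⟧-cong (inMultislice? F N x) (Bal? [] m x) (λ b → bal [] (All.map (⇒cnt≡ x) b)) (λ (bal _ b) → All.map (cnt≡⇒ x) b)))

    nonzeros≡ : ∀ (f : Fun N) → length (filter (λ x → inMultislice? F N x ×-dec ¬? (f x ≟ 0#)) (vecs N)) ≡ nonzeros [] m f
    nonzeros≡ f = trans (length-filter-∑ (λ x → inMultislice? F N x ×-dec ¬? (f x ≟ 0#)) (vecs N)) (∑-cong (vecs N) (λ x →
      ⟦⟧-cong (inMultislice? F N x ×-dec ¬? (f x ≟ 0#)) (Bal? [] m x ×-dec ¬? (f x ≟ 0#))
        (λ (b , nz) → bal [] (All.map (⇒cnt≡ x) b) , nz) (λ (bal _ b , nz) → All.map (cnt≡⇒ x) b , nz)))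

  distinct-elems : 2 ≤ card
  distinct-elems with elems | complete 0# | complete 1#
  ... | x ∷ []    | here refl | here e  = ⊥-elim (0≢1 (sym e))
  ... | x ∷ y ∷ _ | _         | _       = s≤s (s≤s z≤n)

  -- The loss costs `δ(q,d) * loss / m`, at most `M/m` with `M = errorBound r`, uniformly in `d`.
  -- For `n = m q` the square of this times `n` is `M² q / m`, at most 1 beyond the threshold.
  multislice-bound : ∀ r → card ≡ suc (suc r) → ∀ m d (P : Poly F (m * suc (suc r))) → DegreeAtMost F d P →
    (∃[ a ] (InMultislice F (m * suc (suc r)) a × eval F P a ≢ 0#)) →
    errorBound r * errorBound r * suc (suc r) * suc (suc r) ≤ m * suc (suc r) →
    AtMostInvRoot 2 (m * suc (suc r)) (frac (num r d) (den r d) ℚ.- probNonzero F (m * suc (suc r)) P)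
  multislice-bound r card≡ m d P dP (a , ma , nz) n₀≤ =
    subst₂ (λ Z T → AtMostInvRoot 2 (m * q) (frac (num r d) (den r d) ℚ.- frac Z T))
      (sym (nonzeros≡ m card≡ (eval F P))) (sym (size≡ m card≡))
      (difference≤invRoot (num r d) (nonzeros [] m (eval F P)) M (m * q) den>0 size>0 (≤-trans z<s M²q≤m) main
        (≤-trans (≤-reflexive (solve 3 (λ M m q → M :* M :* (m :* q) := M :* M :* q :* m) refl M m q)) (*-monoˡ-≤ m M²q≤m)))
    where
    open ≤-Reasoning
    open NatSolver
    q = suc (suc r)
    M = errorBound r
    ba : Bal [] m a
    ba = bal [] (All.tabulate (λ {t} _ → ⇒cnt≡ m card≡ a (ma t)))
    den>0 : 0 < den r d
    den>0 = m^n>0 q (suc (d / suc r))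
    size>0 : 0 < size {m * q} [] m
    size>0 = ≤-trans (≤-reflexive (sym (⟦⟧-true (Bal? [] m a) ba))) (∈⇒≤∑ (λ x → ⟦ Bal? [] m x ⟧) (allVecs-complete (m * q) a))
    main : num r d * m * size {m * q} [] m ≤ nonzeros [] m (eval F P) * den r d * m + M * den r d * size {m * q} [] m
    main = begin
      -- With truncated subtraction this also covers a `loss` larger than `m`.
      num r d * m * T                                          ≤⟨ *-monoˡ-≤ T (*-monoʳ-≤ (num r d) (m≤n+m∸n m (loss r d))) ⟩
      num r d * (loss r d + (m ∸ loss r d)) * T                ≡⟨ solve 4 (λ a l k t → a :* (l :+ k) :* t := a :* k :* t :+ a :* l :* t) refl (num r d) (loss r d) (m ∸ loss r d) T ⟩
      num r d * (m ∸ loss r d) * T + num r d * loss r d * T    ≤⟨ +-mono-≤ (bound r card≡ m (Deg-eval P dP) (a , ba , nz , [])) (*-monoˡ-≤ T (num*loss≤ r d)) ⟩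
      nonzeros [] m (eval F P) * (den r d * m) + M * den r d * T
        ≡⟨ cong (_+ M * den r d * T) (sym (*-assoc (nonzeros [] m (eval F P)) (den r d) m)) ⟩
      nonzeros [] m (eval F P) * den r d * m + M * den r d * T ∎
      where T = size {m * q} [] m
    M²q≤m : M * M * q ≤ m
    M²q≤m = *-cancelʳ-≤ _ m q n₀≤

theorem1p4 : (q : ℕ) → IsPrimePower q →
    ∃[ k ] ∃[ n₀ ] ((F : FiniteField) → FiniteField.card F ≡ q →
    (n : ℕ) → n₀ ≤ n → q ∣ n → (d : ℕ) → (P : Poly F n) → DegreeAtMost F d P →
    (∃[ a ] (InMultislice F n a × eval F P a ≢ FiniteField.0# F)) →
    AtMostInvRoot (suc k) n (δ q d - probNonzero F n P))
theorem1p4 zero _ = 0 , 0 , λ F card≡ → ⊥-elim (n≮0 (subst (2 ≤_) card≡ (OverField.distinct-elems F)))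
theorem1p4 (suc zero) _ = 0 , 0 , λ F card≡ → ⊥-elim (<-irrefl refl (subst (2 ≤_) card≡ (OverField.distinct-elems F)))
-- The witness `1` means the exponent `c = 1/2`, and the threshold is `(errorBound r * q)²`.
theorem1p4 (suc (suc r)) _ = 1 , errorBound r * errorBound r * suc (suc r) * suc (suc r) ,
  λ { F card≡ n n₀≤ (divides m refl) d P dP nonzero → OverField.multislice-bound F r card≡ m d P dP nonzero n₀≤ }
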